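{- Let $V$ be a commutative generalized bijective variety in the language $L=\{f_1,\ldots,f_n\}$ of unary function symbols, and suppose that the free structure in $V$ on one generator is infinite. Consider presentations with a fixed generating $m$-tuple $\bar a=(a_1,\ldots,a_m)$ and a single identity. Let $F$ be the free structure in $V$ on $\bar a$, and let $L'$ be the result of adding to $L$ constants for the elements of $\bar a$. Then an $L'$-sentence is true in $F$ if and only if it has limiting density $1$.
   Context: A variety is a class of structures, in a language with only function symbols and constants, axiomatized by universally quantified equations; its theory $T$ is the set of logical consequences of the axioms. A variety $V$ with theory $T$ in a language of unary function symbols $f_1,\ldots,f_n$ is generalized bijective if for each $i$, $T\vdash(\forall x,y)(f_i(x)=f_i(y)\to x=y)$ and $T\vdash(\forall y)(\exists x)\,f_i(x)=y$. It is commutative if $T\vdash(\forall x)\,f_i(f_j(x))=f_j(f_i(x))$ for all $i,j$. A presentation $\bar a|R$ consists of the generators $\bar a$ and one identity $R$ of the form $t(a_i)=t'(a_j)$ with $1\le i,j\le m$, where $t,t'$ are arbitrary (possibly empty) finite strings of symbols from $f_1,\ldots,f_n$; identities are counted as ordered pairs (left side, right side). The structure $\langle\bar a|R\rangle$ is the member of $V$ generated by $\bar a$ in which the equations between closed terms in $\bar a$ that hold are exactly those that follow logically from $T\cup\{R\}$; the constants of $L'$ are interpreted as the generators. The free structure on $\bar a$ is the one given by the empty set of identities. The length of $t(a_i)=t'(a_j)$ is the total number of occurrences of function symbols in $t$ and $t'$. Let $P_s$ be the number of presentations whose identity has length at most $s$ and $P_s(\varphi)$ the number of these for which $\langle\bar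 a|R\rangle\models\varphi$. The sentence $\varphi$ has limiting density $d$ if $\lim_{s\to\infty}P_s(\varphi)/P_s=d$. -}

module Defs where

open import Level using (Level; 0ℓ; _⊔_) renaming (suc to lsuc)
open import Data.Empty.Polymorphic using (⊥)
open import Data.Fin using (Fin; zero; suc)
open import Data.Integer using (+_)
open import Data.List using (List; length)
open import Data.List.Membership.Propositional using (_∈_)
open import Data.List.Relation.Unary.Enumerates.Setoid using (IsEnumeration)
open import Data.List.Relation.Unary.Unique.Propositional using (Unique)
open import Data.Nat using (ℕ; suc; _+_; _≤_; NonZero)
open import Data.Product using (Σ; Σ-syntax; ∃; ∃-syntax; _×_; _,_)
open import Data.Rational.Unnormalised using (ℚᵘ; 0ℚᵘ; _/_; _-_; ∣_∣; _<_)
open import Data.Sum using (_⊎_; inj₁; inj₂; [_,_]′)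
open import Data.Vec.Functional using (_∷_; [])
open import Function.Bundles using (Func; _⇔_)
open import Relation.Binary.Bundles using (Setoid)
open import Relation.Binary.PropositionalEquality using (_≡_)
open import Relation.Nullary using (¬_)
open import Relation.Unary using (Pred; ∅; ｛_｝) renaming (_∈_ to _∈ᴾ_)

private variable
  n m k : ℕ
  c ℓ p : Level

-- Terms over unary symbols f_0, …, f_{n-1} with atoms (variables or
-- constants) from X: a string of function symbols applied to one atom.
data Term (n : ℕ) (X : Set) : Set where
  atom : X → Term n X
  app  : Fin n → Term n X → Term n X

size : {X : Set} → Term n X → ℕ
size (atom _)  = 0
size (app _ t) = suc (size t)

-- Equality of a structure is the equivalence relation of its domain, so
-- that quotients such as ⟨ā|R⟩ are available.
record Structure (n : ℕ) (c ℓ : Level) : Set (lsuc (c ⊔ ℓ)) where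
  field
    domain : Setoid c ℓ
    fun    : Fin n → Func domain domain
  open Setoid domain public

  eval : {X : Set} → (X → Carrier) → Term n X → Carrier
  eval ρ (atom x)  = ρ x
  eval ρ (app i t) = Func.to (fun i) (eval ρ t)

-- Formula n m k: first-order formulas of L' (n unary function symbols and
-- m constants) whose free variables are k de Bruijn indices, the most
-- recently bound being zero.  Formulas of L are those with m = 0.
data Formula (n m : ℕ) : ℕ → Set where
  _≐_         : Term n (Fin m ⊎ Fin k) → Term n (Fin m ⊎ Fin k) → Formula n m k
  ⊥′          : Formula n m k
  _∧′_ _∨′_ _⇒′_ : Formula n m k → Formula n m k → Formula n m k
  ∀′_ ∃′_     : Formula n m (suc k) → Formula n m k

infix  8 _≐_
infixr 7 _∧′_
infixr 6 _∨′_
infixr 5 _⇒′_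
infixr 4 ∀′_ ∃′_

Sentence : ℕ → ℕ → Set
Sentence n m = Formula n m 0

v : Fin k → Term n (Fin m ⊎ Fin k)
v x = atom (inj₂ x)

module _ (𝔐 : Structure n c ℓ) where
  open Structure 𝔐

  Sat : (Fin m → Carrier) → (Fin k → Carrier) → Formula n m k → Set (c ⊔ ℓ)
  Sat a ρ (t ≐ u)  = Level.Lift (c ⊔ ℓ) (eval [ a , ρ ]′ t ≈ eval [ a , ρ ]′ u)
  Sat a ρ ⊥′       = ⊥
  Sat a ρ (φ ∧′ ψ) = Sat a ρ φ × Sat a ρ ψ
  Sat a ρ (φ ∨′ ψ) = Sat a ρ φ ⊎ Sat a ρ ψ
  Sat a ρ (φ ⇒′ ψ) = Sat a ρ φ → Sat a ρ ψ
  Sat a ρ (∀′ φ)   = ∀ x → Sat a (x ∷ ρ) φ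
  Sat a ρ (∃′ φ)   = ∃[ x ] Sat a (x ∷ ρ) φ

-- (𝔐 , a) ⊨ φ: truth in the L'-structure expanding 𝔐 by constants a.
_,_⊨_ : (𝔐 : Structure n c ℓ) → (Fin m → Structure.Carrier 𝔐) →
        Sentence n m → Set (c ⊔ ℓ)
𝔐 , a ⊨ φ = Sat 𝔐 a [] φ

-- An equation, understood as universally quantified over all its variables.
Equation : ℕ → Set
Equation n = Term n ℕ × Term n ℕ

-- A variety, given by an arbitrary set of axioms.
Variety : ℕ → Set₁
Variety n = Pred (Equation n) 0ℓ

_∈ⱽ_ : Structure n c ℓ → Variety n → Set (c ⊔ ℓ)
𝔐 ∈ⱽ V = ∀ {t u} → (t , u) ∈ᴾ V → ∀ (ρ : ℕ → Carrier) → eval ρ t ≈ eval ρ u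
  where open Structure 𝔐

-- The theory T of V.  As L is countable, Löwenheim–Skolem makes it harmless
-- to let models range over level 0 only.
Theory : Variety n → Pred (Sentence n 0) (lsuc 0ℓ)
Theory {n} V ψ = (𝔐 : Structure n 0ℓ 0ℓ) → 𝔐 ∈ⱽ V → 𝔐 , [] ⊨ ψ

GeneralizedBijective : Variety n → Set₁
GeneralizedBijective V = ∀ i →
  (∀′ ∀′ app i (v (suc zero)) ≐ app i (v zero) ⇒′ v (suc zero) ≐ v zero) ∈ᴾ Theory V ×
  (∀′ ∃′ app i (v zero) ≐ v (suc zero)) ∈ᴾ Theory V

Commutative : Variety n → Set₁
Commutative V = ∀ i j →
  (∀′ app i (app j (v zero)) ≐ app j (app i (v zero))) ∈ᴾ Theory V

-- Terms t(a_i) and ordered pairs of such terms; constants are Fin m.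
ClosedTerm : ℕ → ℕ → Set
ClosedTerm n m = Term n (Fin m)

Identity : ℕ → ℕ → Set
Identity n m = ClosedTerm n m × ClosedTerm n m

len : Identity n m → ℕ
len (t , u) = size t + size u

_,_⊨ᴵ_ : (𝔐 : Structure n c ℓ) → (Fin m → Structure.Carrier 𝔐) → Identity n m → Set ℓ
𝔐 , a ⊨ᴵ (t , u) = eval a t ≈ eval a u
  where open Structure 𝔐

-- V ∪ S ⊢ e: the identity e follows logically from T together with S
-- (the models of T are exactly the members of V).
_∪_⊢_ : Variety n → Pred (Identity n m) 0ℓ → Identity n m → Set₁
_∪_⊢_ {n} {m} V S e =
  (𝔐 : Structure n 0ℓ 0ℓ) (a : Fin m → Structure.Carrier 𝔐) → 𝔐 ∈ⱽ V →
  (∀ {r} → r ∈ᴾ S → 𝔐 , a ⊨ᴵ r) → 𝔐 , a ⊨ᴵ e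

-- ⟨ā|S⟩, realised on closed terms.
⟨ā∣_⟩ : Pred (Identity n m) 0ℓ → Variety n → Structure n 0ℓ (lsuc 0ℓ)
⟨ā∣_⟩ {n} {m} S V = record
  { domain = record
    { Carrier = ClosedTerm n m
    ; _≈_ = λ t u → V ∪ S ⊢ (t , u)
    ; isEquivalence = record
      { refl  = λ 𝔐 _ _ _ → Structure.refl 𝔐
      ; sym   = λ p 𝔐 a h s → Structure.sym 𝔐 (p 𝔐 a h s)
      ; trans = λ p q 𝔐 a h s → Structure.trans 𝔐 (p 𝔐 a h s) (q 𝔐 a h s)
      }
    }
  ; fun = λ i → record
    { to   = app i
    ; cong = λ p 𝔐 a h s → Func.cong (Structure.fun 𝔐 i) (p 𝔐 a h s)
    }
  }

Free : Variety n → (m : ℕ) → Structure n 0ℓ (lsuc 0ℓ)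
Free V m = ⟨ā∣_⟩ {m = m} ∅ V

FreeSatisfies : Variety n → Sentence n m → Set₁
FreeSatisfies {m = m} V φ = Free V m , atom ⊨ φ

PresentedSatisfies : Variety n → Identity n m → Sentence n m → Set₁
PresentedSatisfies V R φ = ⟨ā∣ ｛ R ｝ ⟩ V , atom ⊨ φ

Infinite : Structure n c ℓ → Set (c ⊔ ℓ)
Infinite 𝔐 = ¬ (∃[ xs ] IsEnumeration (Structure.domain 𝔐) xs)

HasCardinality : {A : Set} → Pred A p → ℕ → Set p
HasCardinality {A = A} Q N =
  Σ[ xs ∈ List A ] Unique xs × (∀ x → x ∈ xs ⇔ Q x) × length xs ≡ N

-- lim P_s(φ)/P_s = d.  The counts P_s and P_s(φ) are given relationally
-- because truth in ⟨ā|R⟩ is not decidable; they are unique when they exist.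
LimitingDensity : Variety n → Sentence n m → ℚᵘ → Set₁
LimitingDensity {n} {m} V φ d =
  Σ[ P ∈ (ℕ → ℕ) ] Σ[ Pφ ∈ (ℕ → ℕ) ]
    (∀ s → HasCardinality {A = Identity n m} (λ R → len R ≤ s) (P s)) ×
    (∀ s → HasCardinality {A = Identity n m}
             (λ R → len R ≤ s × PresentedSatisfies V R φ) (Pφ s)) ×
    (∀ ε → 0ℚᵘ < ε → ∃[ N ] ∀ s → N ≤ s →
      Σ[ nz ∈ NonZero (P s) ] ∣ _/_ (+ Pφ s) (P s) {{nz}} - d ∣ < ε)

{-# OPTIONS --safe #-}
-- In every member of V the symbols act by commuting bijections, so words act
-- through an infinite finitely generated abelian group G, and F consists of m
-- copies of G acting on itself. Such a G has a homomorphism χ to ℤ which does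
-- not vanish on all generators. For R of the form p(a_i) = q(a_j), the element
-- q/p of G is killed in one copy (i = j) or used to glue two copies (i ≠ j). If
-- |χ(q) - χ(p)| is large, ⟨ā|R⟩ therefore looks like F on all short words, and
-- an Ehrenfeucht–Fraïssé game shows that it satisfies φ exactly when F does.
-- It remains to see that |χ(q) - χ(p)| ≤ C is rare. Let a be a letter with
-- χ(a) ≠ 0. An identity of length Q + l can be obtained from one of length l in
-- about Q + 1 ways, putting j letters in front of p and Q - j in front of q; the
-- choices consisting only of a move χ(q) - χ(p) to Q + 1 distinct places, so
-- each value is taken with frequency at most about 1 / (Q + 1) once l is large.
module Submission where

open import Defs
open import Level using (Level; 0ℓ; lift; lower) renaming (suc to lsuc)
open import Axiom.ExcludedMiddle using (ExcludedMiddle)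
open import Data.Bool using (if_then_else_)
open import Data.Empty using (⊥-elim)
open import Data.Fin using (Fin; zero; suc; toℕ)
import Data.Fin.Properties as Fin
open import Data.Integer as ℤ using (ℤ; 0ℤ; 1ℤ; ∣_∣; _⊖_)
import Data.Integer.Properties as ℤ
import Data.Integer.Tactic.RingSolver as ℤSolver
open import Data.List using (List; []; _∷_; _++_; length; foldr; replicate; map; allFin; concat; filter; lookup; applyUpTo; upTo; cartesianProduct; cartesianProductWith)
open import Data.List.Properties using (foldr-++; length-++; length-replicate; length-tabulate; length-applyUpTo; map-++; map-∘; ++-assoc; ++-identityʳ)
open import Data.List.Membership.Propositional using (_∈_)
open import Data.List.Membership.Propositional.Properties
open import Data.List.Relation.Binary.Permutation.Propositional as ↭ using (_↭_; ↭-refl; ↭-sym; ↭-trans; ↭-reflexive)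
open import Data.List.Relation.Binary.Permutation.Propositional.Properties using (++-comm; shift; shifts; ++⁺ˡ)
open import Data.List.Relation.Unary.All as All using ([]; _∷_)
import Data.List.Relation.Unary.All.Properties as All
open import Data.List.Relation.Unary.AllPairs using ([]; _∷_)
import Data.List.Relation.Unary.AllPairs.Properties as AllPairs
open import Data.List.Relation.Unary.Any as Any using (here; there; index)
import Data.List.Relation.Unary.Any.Properties as Any
open import Data.List.Relation.Unary.Unique.Propositional using (Unique)
import Data.List.Relation.Unary.Unique.Propositional.Properties as Unique
open import Data.Nat as ℕ using (ℕ; zero; suc; NonZero; _+_; _*_; _∸_; _^_; _⊔_; _≤_; _<_; z≤n; s≤s)
import Data.Nat.Induction as ℕ
open import Data.Nat.ListAction using (sum)
open import Data.Nat.ListAction.Properties using (sum-++)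
import Data.Nat.Properties as ℕ
import Data.Nat.Tactic.RingSolver as ℕSolver
open import Data.Product using (Σ; ∃-syntax; _×_; _,_; proj₁; proj₂)
open import Data.Rational.Unnormalised as ℚᵘ using (mkℚᵘ; 0ℚᵘ; 1ℚᵘ; ½; *<*; *≡*; _≃_)
import Data.Rational.Unnormalised.Properties as ℚᵘ
open import Data.Sum using (_⊎_; inj₁; inj₂; [_,_]′)
open import Data.Vec.Functional using (Vector; head; tail) renaming ([] to []ᶠ; _∷_ to _∷ᶠ_)
open import Function.Base using (_∘_; const)
open import Function.Bundles using (Func; _⇔_; mk⇔; Equivalence)
open import Relation.Binary.PropositionalEquality as ≡ using (_≡_; _≢_; cong; cong₂; subst; module ≡-Reasoning)
open import Relation.Nullary using (¬_; Dec; yes; no; does)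
open import Relation.Nullary.Decidable using (True; toWitness; fromWitness; decidable-stable)
open import Relation.Unary using (Pred; Decidable; ∅; ｛_｝)

-- Consequence is defined through members of V, so an equation is shown not to follow from R by
-- exhibiting one member: F under a suitable assignment when the two generators differ, a quotient
-- of F when they agree. In both cases χ bounds the damage: if t = s follows from R but fails in F,
-- then χ(t) and χ(s) differ by at least |χ(q) - χ(p)|. The homomorphism χ comes from linear algebra
-- over ℤ: the exponent vectors of relations form a subgroup of ℤ^n. If no nonzero functional killed
-- it, every letter would have finite order and the free structure on one generator would be finite.
-- The frequency estimate is an induction on the length, for all offsets at once. Among the n^Q
-- words that can be spread over the two sides only the power of a is averaged over j; the others
-- merely repeat the bound for length l. Up to boundary terms a frequency c therefore becomes at
-- most (1 - n^-Q) c + n^-Q B / (Q + 1), where B bounds how many of the Q + 1 places lie in the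
-- window. The gain per step is tiny, but the fixed point is B / (Q + 1).

private variable
  n m k : ℕ
  c ℓ : Level
  X : Set

-- Words acting on the members of a variety

Word : ℕ → Set
Word n = List (Fin n)

word : Term n X → Word n
word (atom _)  = []
word (app i t) = i ∷ word t

base : Term n X → X
base (atom x)  = x
base (app _ t) = base t

length-word : (t : Term n X) → length (word t) ≡ size t
length-word (atom _)  = ≡.refl
length-word (app _ t) = cong suc (length-word t)

module Action (𝔐 : Structure n c ℓ) where
  open Structure 𝔐

  act : Word n → Carrier → Carrier
  act w x = foldr (λ i → Func.to (fun i)) x w

  act-++ : ∀ u v x → act (u ++ v) x ≡ act u (act v x)
  act-++ u v x = foldr-++ _ x u v

  act-cong : ∀ w {x y} → x ≈ y → act w x ≈ act w y
  act-cong []      x≈y = x≈y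
  act-cong (i ∷ w) x≈y = Func.cong (fun i) (act-cong w x≈y)

  eval-act : (ρ : X → Carrier) (t : Term n X) → eval ρ t ≡ act (word t) (ρ (base t))
  eval-act ρ (atom _)  = ≡.refl
  eval-act ρ (app i t) = cong (Func.to (fun i)) (eval-act ρ t)

record CommutingBijections (𝔐 : Structure n c ℓ) : Set (c Level.⊔ ℓ) where
  open Structure 𝔐
  open Action 𝔐
  private
    f : Fin n → Carrier → Carrier
    f i = Func.to (fun i)
  field
    commute    : ∀ i j x → f i (f j x) ≈ f j (f i x)
    injective  : ∀ i {x y} → f i x ≈ f i y → x ≈ y
    surjective : ∀ i y → ∃[ x ] f i x ≈ y

  act-↭ : ∀ {u v} → u ↭ v → ∀ x → act u x ≈ act v x
  act-↭ ↭.refl x = Structure.refl 𝔐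
  act-↭ (↭.prep i p) x = Func.cong (fun i) (act-↭ p x)
  act-↭ (↭.swap {xs = u} i j p) x =
    Structure.trans 𝔐 (commute i j (act u x)) (Func.cong (fun j) (Func.cong (fun i) (act-↭ p x)))
  act-↭ (↭.trans p q) x = Structure.trans 𝔐 (act-↭ p x) (act-↭ q x)

  act-injective : ∀ w {x y} → act w x ≈ act w y → x ≈ y
  act-injective []      e = e
  act-injective (i ∷ w) e = act-injective w (injective i e)

  act-surjective : ∀ w y → ∃[ x ] act w x ≈ y
  act-surjective []      y = y , Structure.refl 𝔐
  act-surjective (i ∷ w) y with surjective i y
  ... | z , fz≈y with act-surjective w z
  ... | x , wx≈z = x , Structure.trans 𝔐 (Func.cong (fun i) wx≈z) fz≈y

  act-comm : ∀ u v x → act u (act v x) ≈ act v (act u x)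
  act-comm u v x = ≡.subst₂ _≈_ (act-++ u v x) (act-++ v u x) (act-↭ (++-comm u v) x)

-- The group of words and the free structure

module Variety-theory (em : ExcludedMiddle (lsuc 0ℓ)) {n : ℕ} (V : Variety n)
  (bijective : GeneralizedBijective V) (commutative : Commutative V) where

  members-bijective : (𝔐 : Structure n 0ℓ 0ℓ) → 𝔐 ∈ⱽ V → CommutingBijections 𝔐
  members-bijective 𝔐 𝔐∈V = record
    { commute    = λ i j x → lower (commutative i j 𝔐 𝔐∈V x)
    ; injective  = λ i {x} {y} e → lower (proj₁ (bijective i) 𝔐 𝔐∈V x y (lift e))
    ; surjective = λ i y → let x , e = proj₂ (bijective i) 𝔐 𝔐∈V y in x , lower e
    }

  infix 4 _≋_
  -- Equality in the group G of the overview. Words have no inverses, so an element of G is handled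
  -- as a quotient of two words throughout. The record wrapper lets `u` and `v` be inferred from a
  -- proof.
  record _≋_ (u v : Word n) : Set₁ where
    constructor valid
    field
      holds : (𝔐 : Structure n 0ℓ 0ℓ) → 𝔐 ∈ⱽ V →
              ∀ x → Structure._≈_ 𝔐 (Action.act 𝔐 u x) (Action.act 𝔐 v x)
  open _≋_ public

  ≋-refl : ∀ {u} → u ≋ u
  ≋-refl = valid λ 𝔐 _ _ → Structure.refl 𝔐

  ≋-sym : ∀ {u v} → u ≋ v → v ≋ u
  ≋-sym p = valid λ 𝔐 h x → Structure.sym 𝔐 (holds p 𝔐 h x)

  ≋-trans : ∀ {u v w} → u ≋ v → v ≋ w → u ≋ w
  ≋-trans p q = valid λ 𝔐 h x → Structure.trans 𝔐 (holds p 𝔐 h x) (holds q 𝔐 h x)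

  ↭⇒≋ : ∀ {u v} → u ↭ v → u ≋ v
  ↭⇒≋ p = valid λ 𝔐 h → CommutingBijections.act-↭ (members-bijective 𝔐 h) p

  ++-congʳ : ∀ w {u v} → u ≋ v → w ++ u ≋ w ++ v
  ++-congʳ w {u} {v} p = valid λ 𝔐 h x →
    ≡.subst₂ (Structure._≈_ 𝔐) (≡.sym (Action.act-++ 𝔐 w u x)) (≡.sym (Action.act-++ 𝔐 w v x))
      (Action.act-cong 𝔐 w (holds p 𝔐 h x))

  ++-congˡ : ∀ w {u v} → u ≋ v → u ++ w ≋ v ++ w
  ++-congˡ w {u} {v} p = ≋-trans (↭⇒≋ (++-comm u w)) (≋-trans (++-congʳ w p) (↭⇒≋ (++-comm w v)))

  ++-cancelˡ : ∀ w {u v} → w ++ u ≋ w ++ v → u ≋ v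
  ++-cancelˡ w {u} {v} p = valid λ 𝔐 h x →
    CommutingBijections.act-injective (members-bijective 𝔐 h) w
      (≡.subst₂ (Structure._≈_ 𝔐) (Action.act-++ 𝔐 w u x) (Action.act-++ 𝔐 w v x) (holds p 𝔐 h x))

  ++-cancelʳ : ∀ w {u v} → u ++ w ≋ v ++ w → u ≋ v
  ++-cancelʳ w {u} {v} p = ++-cancelˡ w (≋-trans (↭⇒≋ (++-comm w u)) (≋-trans p (↭⇒≋ (++-comm v w))))

  -- Equality in ⟨ā|S⟩ lives in Set₁, while the members of V that test
  -- consequences of V live in Set; excluded middle bridges the gap.
  resize : Structure n 0ℓ (lsuc 0ℓ) → Structure n 0ℓ 0ℓ
  resize 𝔑 = record
    { domain = record
      { Carrier = Carrier
      ; _≈_ = λ x y → True (em {x ≈ y})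
      ; isEquivalence = record
        { refl  = λ {x} → fromWitness (refl′ {x})
        ; sym   = λ {x} {y} p → fromWitness (sym′ {x} {y} (toWitness p))
        ; trans = λ {x} {y} {z} p q → fromWitness (trans′ {x} {y} {z} (toWitness p) (toWitness q))
        }
      }
    ; fun = λ i → record
      { to   = Func.to (fun i)
      ; cong = λ p → fromWitness (Func.cong (fun i) (toWitness p))
      }
    }
    where open Structure 𝔑 renaming (refl to refl′; sym to sym′; trans to trans′)

  eval-resize : (𝔑 : Structure n 0ℓ (lsuc 0ℓ)) (ρ : X → Structure.Carrier 𝔑) (t : Term n X) →
                Structure.eval (resize 𝔑) ρ t ≡ Structure.eval 𝔑 ρ t
  eval-resize 𝔑 ρ (atom _)  = ≡.refl
  eval-resize 𝔑 ρ (app i t) = cong (Func.to (Structure.fun 𝔑 i)) (eval-resize 𝔑 ρ t)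

  module Presented {m : ℕ} (S : Pred (Identity n m) 0ℓ) where
    𝔖 : Structure n 0ℓ (lsuc 0ℓ)
    𝔖 = ⟨ā∣ S ⟩ V
    open Structure 𝔖 public
    open Action 𝔖 public

    word-act : ∀ w t → word (act w t) ≡ w ++ word t
    word-act []      t = ≡.refl
    word-act (i ∷ w) t = cong (i ∷_) (word-act w t)

    base-act : ∀ w t → base (act w t) ≡ base t
    base-act []      t = ≡.refl
    base-act (i ∷ w) t = base-act w t

    act-eval : (𝔐 : Structure n 0ℓ 0ℓ) (a : Fin m → Structure.Carrier 𝔐) → ∀ w t →
               Structure.eval 𝔐 a (act w t) ≡ Action.act 𝔐 w (Structure.eval 𝔐 a t)
    act-eval 𝔐 a []      t = ≡.refl
    act-eval 𝔐 a (i ∷ w) t = cong (Func.to (Structure.fun 𝔐 i)) (act-eval 𝔐 a w t)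

    private
      eval-eval : (𝔐 : Structure n 0ℓ 0ℓ) (a : Fin m → Structure.Carrier 𝔐)
                  (ρ : X → ClosedTerm n m) (t : Term n X) →
                  Structure.eval 𝔐 a (eval ρ t) ≡ Structure.eval 𝔐 (Structure.eval 𝔐 a ∘ ρ) t
      eval-eval 𝔐 a ρ (atom x)  = ≡.refl
      eval-eval 𝔐 a ρ (app i t) = cong (Func.to (Structure.fun 𝔐 i)) (eval-eval 𝔐 a ρ t)

    ∈V : 𝔖 ∈ⱽ V
    ∈V {t} {u} e ρ 𝔐 a h s =
      ≡.subst₂ (Structure._≈_ 𝔐) (≡.sym (eval-eval 𝔐 a ρ t)) (≡.sym (eval-eval 𝔐 a ρ u)) (h e _)

    resize-∈V : resize 𝔖 ∈ⱽ V
    resize-∈V {t} {u} e ρ = fromWitness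
      (≡.subst₂ _≈_ (≡.sym (eval-resize 𝔖 ρ t)) (≡.sym (eval-resize 𝔖 ρ u)) (∈V e ρ))

    -- The hypotheses on V speak only of structures in `Set`; they are applied to the resized copy
    -- and the conclusions carried back.
    commutingBijections : CommutingBijections 𝔖
    commutingBijections = record
      { commute    = λ i j x → toWitness (commute i j x)
      ; injective  = λ i {x} {y} e → toWitness (injective i {x} {y} (fromWitness e))
      ; surjective = λ i y → let x , e = surjective i y in x , toWitness e
      }
      where open CommutingBijections (members-bijective (resize 𝔖) resize-∈V)
    open CommutingBijections commutingBijections public

    ≋⇒≈ : ∀ {u v} → u ≋ v → ∀ x → act u x ≈ act v x
    ≋⇒≈ {u} {v} p x 𝔐 a h s =
      ≡.subst₂ (Structure._≈_ 𝔐) (≡.sym (act-eval 𝔐 a u x)) (≡.sym (act-eval 𝔐 a v x)) (holds p 𝔐 h _)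

    canonical : ∀ t → t ≡ act (word t) (atom (base t))
    canonical (atom _)  = ≡.refl
    canonical (app i t) = cong (app i) (canonical t)

  module FreeStructure (infinite : Infinite (Free V 1)) {m : ℕ} where
    open Presented {m} ∅ public

    -- Interpreting every generator by the same element turns an equation of F into an identity in
    -- one variable.
    free⇒≋ : ∀ t u → t ≈ u → word t ≋ word u
    free⇒≋ t u p = valid λ 𝔐 h x →
      ≡.subst₂ (Structure._≈_ 𝔐) (Action.eval-act 𝔐 _ t) (Action.eval-act 𝔐 _ u)
        (p 𝔐 (const x) h λ ())

    -- An equation between words on two different generators would collapse every member of V.
    free⇒base : ∀ t u → t ≈ u → base t ≡ base u
    free⇒base t u p with base t Fin.≟ base u
    ... | yes e = e
    ... | no  ne = ⊥-elim (infinite (atom zero ∷ [] , λ x → here (λ 𝔐 a h s → collapse 𝔐 h _ _)))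
      where
      module _ (𝔐 : Structure n 0ℓ 0ℓ) (h : 𝔐 ∈ⱽ V) where
        open Structure 𝔐 using () renaming (_≈_ to _∼_; Carrier to C; trans to ∼-trans; sym to ∼-sym)
        open Action 𝔐 using () renaming (act to act′)
        assign : C → C → Fin m → C
        assign x y i with i Fin.≟ base t
        ... | yes _ = x
        ... | no  _ = y
        assign-t : ∀ x y → assign x y (base t) ≡ x
        assign-t x y with base t Fin.≟ base t
        ... | yes _ = ≡.refl
        ... | no ¬p = ⊥-elim (¬p ≡.refl)
        assign-u : ∀ x y → assign x y (base u) ≡ y
        assign-u x y with base u Fin.≟ base t
        ... | yes e = ⊥-elim (ne (≡.sym e))
        ... | no _  = ≡.refl
        link : ∀ x y → act′ (word t) x ∼ act′ (word u) y
        link x y = ≡.subst₂ _∼_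
          (≡.trans (Action.eval-act 𝔐 _ t) (cong (act′ (word t)) (assign-t x y)))
          (≡.trans (Action.eval-act 𝔐 _ u) (cong (act′ (word u)) (assign-u x y)))
          (p 𝔐 (assign x y) h λ ())
        -- Both `act′ (word t) x` and `act′ (word t) y` equal `act′ (word u) x`, because the two
        -- sides can be assigned independently.
        collapse : ∀ x y → x ∼ y
        collapse x y = CommutingBijections.act-injective (members-bijective 𝔐 h) (word t)
          (∼-trans (link x x) (∼-sym (link y x)))

-- The back-and-forth game

private variable
  L L′ r : ℕ

wordsUpTo : (n r : ℕ) → List (Word n)
wordsUpTo n zero    = [] ∷ []
wordsUpTo n (suc r) = [] ∷ cartesianProductWith _∷_ (allFin n) (wordsUpTo n r)

∈-wordsUpTo : (w : Word n) → length w ≤ r → w ∈ wordsUpTo n r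
∈-wordsUpTo {r = zero}  []      _       = here ≡.refl
∈-wordsUpTo {r = suc r} []      _       = here ≡.refl
∈-wordsUpTo {r = suc r} (i ∷ w) (s≤s l) = there (∈-cartesianProductWith⁺ _∷_ (∈-allFin i) (∈-wordsUpTo w l))

atoms : (m k : ℕ) → List (Fin m ⊎ Fin k)
atoms m k = map inj₁ (allFin m) ++ map inj₂ (allFin k)

∈-atoms : (p : Fin m ⊎ Fin k) → p ∈ atoms m k
∈-atoms (inj₁ i) = ∈-++⁺ˡ (∈-map⁺ inj₁ (∈-allFin i))
∈-atoms (inj₂ j) = ∈-++⁺ʳ _ (∈-map⁺ inj₂ (∈-allFin j))

links : (n m k r : ℕ) → List (Word n × Word n × (Fin m ⊎ Fin k))
links n m k r = cartesianProduct (wordsUpTo n r) (cartesianProduct (wordsUpTo n r) (atoms m k))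

-- Twice the radius lets a short link to an old element be composed with
-- short words; the length of links lets the pigeonhole principle find an
-- element with no short link to the old ones.
radius : Formula n m k → ℕ
extend : (n m k r : ℕ) → ℕ
extend n m k r = (r + r) + length (links n m k r)
radius (t ≐ u)  = size t + size u
radius ⊥′       = 0
radius (φ ∧′ ψ) = radius φ + radius ψ
radius (φ ∨′ ψ) = radius φ + radius ψ
radius (φ ⇒′ ψ) = radius φ + radius ψ
radius {n} {m} {k} (∀′ φ) = extend n m k (radius φ)
radius {n} {m} {k} (∃′ φ) = extend n m k (radius φ)

first : .{{NonZero m}} → Fin m
first {m = suc _} = zero

-- The game asks of the theory only for an equality of words and a letter `h` of infinite order,
-- whose powers supply as many distinct points as a move may require.
module Game (em : ExcludedMiddle (lsuc 0ℓ)) {n m : ℕ} .{{_ : NonZero m}}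
  (_≋_ : Word n → Word n → Set₁)
  (h : Fin n) (powers-distinct : ∀ {i j} → replicate i h ≋ replicate j h → i ≡ j) where

  record Pointed : Set₂ where
    field
      structure : Structure n 0ℓ (lsuc 0ℓ)
      constants : Fin m → Structure.Carrier structure
      commutingBijections : CommutingBijections structure
    open Structure structure public
    open Action structure public
    open CommutingBijections commutingBijections public
    field
      ≋⇒≈ : ∀ {u v} → u ≋ v → ∀ x → act u x ≈ act v x

    point : (Fin k → Carrier) → Fin m ⊎ Fin k → Carrier
    point ρ = [ constants , ρ ]′

    FreeUpTo : ℕ → Set₁
    FreeUpTo L = ∀ x u v → length u ≤ L → length v ≤ L → act u x ≈ act v x → u ≋ v

    -- With inverses this would be x = u⁻¹ v p, that is, x is near the old point p in the Cayley
    -- graph.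
    Linked : ℕ → (Fin k → Carrier) → Carrier → Set₁
    Linked {k} r ρ x = ∃[ u ] ∃[ v ] ∃[ p ] length u ≤ r × length v ≤ r × act u x ≈ act v (point {k} ρ p)

  open Pointed

  -- Half of the invariant of the game; the other half is the same condition with the two structures
  -- exchanged.
  Preserves : ℕ → (𝔐 𝔑 : Pointed) → (Fin k → Carrier 𝔐) → (Fin k → Carrier 𝔑) → Set₁
  Preserves L 𝔐 𝔑 ρ ρ′ = ∀ p q u v → length u ≤ L → length v ≤ L →
    _≈_ 𝔐 (act 𝔐 u (point 𝔐 ρ p)) (act 𝔐 v (point 𝔐 ρ q)) →
    _≈_ 𝔑 (act 𝔑 u (point 𝔑 ρ′ p)) (act 𝔑 v (point 𝔑 ρ′ q))

  FreeUpTo-≤ : ∀ 𝔐 → L ≤ L′ → FreeUpTo 𝔐 L′ → FreeUpTo 𝔐 L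
  FreeUpTo-≤ 𝔐 le F x u v lu lv = F x u v (ℕ.≤-trans lu le) (ℕ.≤-trans lv le)

  Preserves-≤ : ∀ 𝔐 𝔑 {ρ : Fin k → Carrier 𝔐} {ρ′} → L ≤ L′ → Preserves L′ 𝔐 𝔑 ρ ρ′ → Preserves L 𝔐 𝔑 ρ ρ′
  Preserves-≤ 𝔐 𝔑 le P p q u v lu lv = P p q u v (ℕ.≤-trans lu le) (ℕ.≤-trans lv le)

  -- There is one more power of `h` than there are possible links. If all these powers, applied to a
  -- constant, were linked, two would share a link (u, v, p); cancelling u makes them equal at that
  -- constant, and local freeness then makes two distinct powers equal in G.
  unlinked : ∀ 𝔐 (ρ : Fin k → Carrier 𝔐) → FreeUpTo 𝔐 (extend n m k r) → ∃[ x ] ¬ Linked 𝔐 r ρ x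
  unlinked {k} {r} 𝔐 ρ F with em {∃[ x ] ¬ Linked 𝔐 r ρ x}
  ... | yes e = e
  ... | no ¬e = ⊥-elim (ℕ.<⇒≢ (proj₁ (proj₂ (proj₂ clash))) (powers-distinct equal))
    where
    N : ℕ
    N = length (links n m k r)
    o : Carrier 𝔐
    o = constants 𝔐 first
    power : Fin (suc N) → Word n
    power j = replicate (toℕ j) h
    short : ∀ j → length (power j) ≤ extend n m k r
    short j = ℕ.≤-trans (ℕ.≤-reflexive (length-replicate (toℕ j)))
                (ℕ.≤-trans (Fin.toℕ≤pred[n] j) (ℕ.m≤n+m N (r + r)))
    linked : ∀ j → Linked 𝔐 r ρ (act 𝔐 (power j) o)
    linked j with em {Linked 𝔐 r ρ (act 𝔐 (power j) o)}
    ... | yes l = l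
    ... | no ¬l = ⊥-elim (¬e (_ , ¬l))
    link : Fin (suc N) → Word n × Word n × (Fin m ⊎ Fin k)
    link j = let u , v , p , _ = linked j in u , v , p
    link∈ : ∀ j → link j ∈ links n m k r
    link∈ j = let u , v , p , lu , lv , _ = linked j in
      ∈-cartesianProduct⁺ (∈-wordsUpTo u lu) (∈-cartesianProduct⁺ (∈-wordsUpTo v lv) (∈-atoms p))
    clash = Fin.pigeonhole (ℕ.n<1+n N) (λ j → index (link∈ j))
    i j : Fin (suc N)
    i = proj₁ clash
    j = proj₁ (proj₂ clash)
    same : link i ≡ link j
    same = ≡.trans (Any.lookup-index (link∈ i))
      (≡.trans (cong (lookup (links n m k r)) (proj₂ (proj₂ (proj₂ clash)))) (≡.sym (Any.lookup-index (link∈ j))))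
    holds-at : ∀ j → let u , v , p = link j in _≈_ 𝔐 (act 𝔐 u (act 𝔐 (power j) o)) (act 𝔐 v (point 𝔐 ρ p))
    holds-at j = let _ , _ , _ , _ , _ , e = linked j in e
    holds-at-i : let u , v , p = link j in _≈_ 𝔐 (act 𝔐 u (act 𝔐 (power i) o)) (act 𝔐 v (point 𝔐 ρ p))
    holds-at-i = subst (λ (u , v , p) → _≈_ 𝔐 (act 𝔐 u (act 𝔐 (power i) o)) (act 𝔐 v (point 𝔐 ρ p)))
                   same (holds-at i)
    equal : power i ≋ power j
    equal = F o (power i) (power j) (short i) (short j)
      (act-injective 𝔐 (proj₁ (link j)) (trans 𝔐 holds-at-i (sym 𝔐 (holds-at j))))

  -- Only equations between the new point and an old one are left as an assumption: an equation of
  -- the new point with itself comes from an equality in G by local freeness, and so holds at every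
  -- point of 𝔑.
  preserves-∷ : ∀ 𝔐 𝔑 {ρ : Fin k → Carrier 𝔐} {ρ′ x x′} → FreeUpTo 𝔐 r → Preserves r 𝔐 𝔑 ρ ρ′ →
    (∀ q u v → length u ≤ r → length v ≤ r → _≈_ 𝔐 (act 𝔐 u x) (act 𝔐 v (point 𝔐 ρ q)) →
                                             _≈_ 𝔑 (act 𝔑 u x′) (act 𝔑 v (point 𝔑 ρ′ q))) →
    Preserves r 𝔐 𝔑 (x ∷ᶠ ρ) (x′ ∷ᶠ ρ′)
  preserves-∷ 𝔐 𝔑 F P C (inj₂ zero)    (inj₂ zero)    u v lu lv e = ≋⇒≈ 𝔑 (F _ u v lu lv e) _
  preserves-∷ 𝔐 𝔑 F P C (inj₂ zero)    (inj₁ q)       u v lu lv e = C (inj₁ q) u v lu lv e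
  preserves-∷ 𝔐 𝔑 F P C (inj₂ zero)    (inj₂ (suc q)) u v lu lv e = C (inj₂ q) u v lu lv e
  preserves-∷ 𝔐 𝔑 F P C (inj₁ p)       (inj₂ zero)    u v lu lv e = sym 𝔑 (C (inj₁ p) v u lv lu (sym 𝔐 e))
  preserves-∷ 𝔐 𝔑 F P C (inj₂ (suc p)) (inj₂ zero)    u v lu lv e = sym 𝔑 (C (inj₂ p) v u lv lu (sym 𝔐 e))
  preserves-∷ 𝔐 𝔑 F P C (inj₁ p)       (inj₁ q)       = P (inj₁ p) (inj₁ q)
  preserves-∷ 𝔐 𝔑 F P C (inj₁ p)       (inj₂ (suc q)) = P (inj₁ p) (inj₂ q)
  preserves-∷ 𝔐 𝔑 F P C (inj₂ (suc p)) (inj₁ q)       = P (inj₂ p) (inj₁ q)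
  preserves-∷ 𝔐 𝔑 F P C (inj₂ (suc p)) (inj₂ (suc q)) = P (inj₂ p) (inj₂ q)

  -- If b x ≈ c y in both structures, then u x ≈ v z is equivalent to u c y ≈ b v z.
  preserves-linked : ∀ 𝔐 𝔑 {ρ : Fin k → Carrier 𝔐} {ρ′ x x′} p b c → length b ≤ r → length c ≤ r →
    _≈_ 𝔐 (act 𝔐 b x) (act 𝔐 c (point 𝔐 ρ p)) → _≈_ 𝔑 (act 𝔑 b x′) (act 𝔑 c (point 𝔑 ρ′ p)) →
    Preserves (r + r) 𝔐 𝔑 ρ ρ′ →
    ∀ q u v → length u ≤ r → length v ≤ r → _≈_ 𝔐 (act 𝔐 u x) (act 𝔐 v (point 𝔐 ρ q)) →
                                             _≈_ 𝔑 (act 𝔑 u x′) (act 𝔑 v (point 𝔑 ρ′ q))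
  preserves-linked {r = r} 𝔐 𝔑 {ρ} {ρ′} {x} {x′} p b c lb lc e e′ P q u v lu lv d =
    act-injective 𝔑 b (trans 𝔑 (act-comm 𝔑 b u x′) (trans 𝔑 (act-cong 𝔑 u e′) uc≈bv′))
    where
    long : ∀ (w w₁ : Word n) → length w ≤ r → length w₁ ≤ r → length (w ++ w₁) ≤ r + r
    long w w₁ l l₁ = ℕ.≤-trans (ℕ.≤-reflexive (length-++ w)) (ℕ.+-mono-≤ l l₁)
    uc≈bv : _≈_ 𝔐 (act 𝔐 u (act 𝔐 c (point 𝔐 ρ p))) (act 𝔐 b (act 𝔐 v (point 𝔐 ρ q)))
    uc≈bv = trans 𝔐 (act-cong 𝔐 u (sym 𝔐 e)) (trans 𝔐 (act-comm 𝔐 u b x) (act-cong 𝔐 b d))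
    uc≈bv′ : _≈_ 𝔑 (act 𝔑 u (act 𝔑 c (point 𝔑 ρ′ p))) (act 𝔑 b (act 𝔑 v (point 𝔑 ρ′ q)))
    uc≈bv′ = ≡.subst₂ (_≈_ 𝔑) (act-++ 𝔑 u c _) (act-++ 𝔑 b v _)
      (P p q (u ++ c) (b ++ v) (long u c lu lc) (long b v lb lv)
        (≡.subst₂ (_≈_ 𝔐) (≡.sym (act-++ 𝔐 u c _)) (≡.sym (act-++ 𝔐 b v _)) uc≈bv))

  -- A linked point is answered by a solution of the same link equation on the other side, and an
  -- unlinked point by any unlinked point, since then no short equation ties either of them to the
  -- old points.
  answer : ∀ 𝔐 𝔑 {ρ : Fin k → Carrier 𝔐} {ρ′} → let R = extend n m k r in
    FreeUpTo 𝔐 R → FreeUpTo 𝔑 R → Preserves R 𝔐 𝔑 ρ ρ′ → Preserves R 𝔑 𝔐 ρ′ ρ →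
    ∀ x → ∃[ x′ ] Preserves r 𝔐 𝔑 (x ∷ᶠ ρ) (x′ ∷ᶠ ρ′) × Preserves r 𝔑 𝔐 (x′ ∷ᶠ ρ′) (x ∷ᶠ ρ)
  answer {k} {r} 𝔐 𝔑 {ρ} {ρ′} F F′ P P′ x = go (em {Linked 𝔐 r ρ x})
    where
    2r≤R : r + r ≤ extend n m k r
    2r≤R = ℕ.m≤m+n (r + r) _
    r≤R : r ≤ extend n m k r
    r≤R = ℕ.≤-trans (ℕ.m≤m+n r r) 2r≤R
    Pᵣ  = Preserves-≤ 𝔐 𝔑 r≤R P
    Pᵣ′ = Preserves-≤ 𝔑 𝔐 r≤R P′
    Fᵣ  = FreeUpTo-≤ 𝔐 r≤R F
    Fᵣ′ = FreeUpTo-≤ 𝔑 r≤R F′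
    go : _ → ∃[ x′ ] Preserves r 𝔐 𝔑 (x ∷ᶠ ρ) (x′ ∷ᶠ ρ′) × Preserves r 𝔑 𝔐 (x′ ∷ᶠ ρ′) (x ∷ᶠ ρ)
    go (yes (b , c , p , lb , lc , e)) with act-surjective 𝔑 b (act 𝔑 c (point 𝔑 ρ′ p))
    ... | x′ , e′ = x′
        , preserves-∷ 𝔐 𝔑 Fᵣ Pᵣ (preserves-linked 𝔐 𝔑 {ρ} {ρ′} p b c lb lc e e′ (Preserves-≤ 𝔐 𝔑 2r≤R P))
        , preserves-∷ 𝔑 𝔐 Fᵣ′ Pᵣ′ (preserves-linked 𝔑 𝔐 {ρ′} {ρ} p b c lb lc e′ e (Preserves-≤ 𝔑 𝔐 2r≤R P′))
    go (no ¬l) with unlinked {r = r} 𝔑 ρ′ F′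
    ... | x′ , ¬l′ = x′
        , preserves-∷ 𝔐 𝔑 Fᵣ Pᵣ (λ q u v lu lv e → ⊥-elim (¬l (u , v , q , lu , lv , e)))
        , preserves-∷ 𝔑 𝔐 Fᵣ′ Pᵣ′ (λ q u v lu lv e → ⊥-elim (¬l′ (u , v , q , lu , lv , e)))

  -- Induction on φ. Implication and the universal quantifier exchange the two structures, so both
  -- halves of the invariant and freeness on both sides are carried along. Each quantifier spends
  -- the passage from `extend` to the radius of its body.
  transfer : (φ : Formula n m k) → radius φ ≤ L → ∀ 𝔐 𝔑 {ρ : Fin k → Carrier 𝔐} {ρ′} →
    FreeUpTo 𝔐 L → FreeUpTo 𝔑 L → Preserves L 𝔐 𝔑 ρ ρ′ → Preserves L 𝔑 𝔐 ρ′ ρ →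
    Sat (structure 𝔐) (constants 𝔐) ρ φ → Sat (structure 𝔑) (constants 𝔑) ρ′ φ
  transfer (t ≐ u) le 𝔐 𝔑 F F′ P P′ (lift e) = lift
    (≡.subst₂ (_≈_ 𝔑) (≡.sym (eval-act 𝔑 _ t)) (≡.sym (eval-act 𝔑 _ u))
      (P (base t) (base u) (word t) (word u)
        (ℕ.≤-trans (ℕ.≤-reflexive (length-word t)) (ℕ.≤-trans (ℕ.m≤m+n _ _) le))
        (ℕ.≤-trans (ℕ.≤-reflexive (length-word u)) (ℕ.≤-trans (ℕ.m≤n+m _ _) le))
        (≡.subst₂ (_≈_ 𝔐) (eval-act 𝔐 _ t) (eval-act 𝔐 _ u) e)))
  transfer (φ ∧′ ψ) le 𝔐 𝔑 F F′ P P′ (a , b) =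
    transfer φ (ℕ.≤-trans (ℕ.m≤m+n _ _) le) 𝔐 𝔑 F F′ P P′ a ,
    transfer ψ (ℕ.≤-trans (ℕ.m≤n+m _ _) le) 𝔐 𝔑 F F′ P P′ b
  transfer (φ ∨′ ψ) le 𝔐 𝔑 F F′ P P′ (inj₁ a) = inj₁ (transfer φ (ℕ.≤-trans (ℕ.m≤m+n _ _) le) 𝔐 𝔑 F F′ P P′ a)
  transfer (φ ∨′ ψ) le 𝔐 𝔑 F F′ P P′ (inj₂ b) = inj₂ (transfer ψ (ℕ.≤-trans (ℕ.m≤n+m _ _) le) 𝔐 𝔑 F F′ P P′ b)
  transfer (φ ⇒′ ψ) le 𝔐 𝔑 F F′ P P′ f a =
    transfer ψ (ℕ.≤-trans (ℕ.m≤n+m _ _) le) 𝔐 𝔑 F F′ P P′ (f (transfer φ (ℕ.≤-trans (ℕ.m≤m+n _ _) le) 𝔑 𝔐 F′ F P′ P a))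
  transfer (∀′ φ) le 𝔐 𝔑 F F′ P P′ f x′ =
    let x , Q′ , Q = answer {r = radius φ} 𝔑 𝔐 (FreeUpTo-≤ 𝔑 le F′) (FreeUpTo-≤ 𝔐 le F)
                       (Preserves-≤ 𝔑 𝔐 le P′) (Preserves-≤ 𝔐 𝔑 le P) x′
        r≤L = ℕ.≤-trans (ℕ.m≤m+n _ _) (ℕ.≤-trans (ℕ.m≤m+n _ _) le)
    in transfer φ ℕ.≤-refl 𝔐 𝔑 (FreeUpTo-≤ 𝔐 r≤L F) (FreeUpTo-≤ 𝔑 r≤L F′) Q Q′ (f x)
  transfer (∃′ φ) le 𝔐 𝔑 F F′ P P′ (x , s) =
    let x′ , Q , Q′ = answer {r = radius φ} 𝔐 𝔑 (FreeUpTo-≤ 𝔐 le F) (FreeUpTo-≤ 𝔑 le F′)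
                        (Preserves-≤ 𝔐 𝔑 le P) (Preserves-≤ 𝔑 𝔐 le P′) x
        r≤L = ℕ.≤-trans (ℕ.m≤m+n _ _) (ℕ.≤-trans (ℕ.m≤m+n _ _) le)
    in x′ , transfer φ ℕ.≤-refl 𝔐 𝔑 (FreeUpTo-≤ 𝔐 r≤L F) (FreeUpTo-≤ 𝔑 r≤L F′) Q Q′ s

-- A nonzero character

dot : Vector ℤ n → Vector ℤ n → ℤ
dot {zero}  x z = 0ℤ
dot {suc n} x z = x zero ℤ.* z zero ℤ.+ dot (x ∘ suc) (z ∘ suc)

dot-congʳ : (x : Vector ℤ n) {y z : Vector ℤ n} → (∀ i → y i ≡ z i) → dot x y ≡ dot x z
dot-congʳ {zero}  x e = ≡.refl
dot-congʳ {suc n} x e = cong₂ ℤ._+_ (cong (x zero ℤ.*_) (e zero)) (dot-congʳ (x ∘ suc) (e ∘ suc))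

dot-scaleˡ : ∀ c (x z : Vector ℤ n) → dot (λ i → c ℤ.* x i) z ≡ c ℤ.* dot x z
dot-scaleˡ {zero}  c x z = ≡.sym (ℤ.*-zeroʳ c)
dot-scaleˡ {suc n} c x z rewrite dot-scaleˡ c (x ∘ suc) (z ∘ suc) = lemma c (x zero) (z zero) _
  where
  lemma : ∀ c x z d → c ℤ.* x ℤ.* z ℤ.+ c ℤ.* d ≡ c ℤ.* (x ℤ.* z ℤ.+ d)
  lemma = ℤSolver.solve-∀

dot-linear : ∀ a b (x y z : Vector ℤ n) → dot x (λ i → a ℤ.* y i ℤ.+ b ℤ.* z i) ≡ a ℤ.* dot x y ℤ.+ b ℤ.* dot x z
dot-linear {zero}  a b x y z = ≡.sym (cong₂ ℤ._+_ (ℤ.*-zeroʳ a) (ℤ.*-zeroʳ b))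
dot-linear {suc n} a b x y z rewrite dot-linear a b (x ∘ suc) (y ∘ suc) (z ∘ suc) =
  lemma a b (x zero) (y zero) (z zero) _ _
  where
  lemma : ∀ a b x y z d e → x ℤ.* (a ℤ.* y ℤ.+ b ℤ.* z) ℤ.+ (a ℤ.* d ℤ.+ b ℤ.* e) ≡ a ℤ.* (x ℤ.* y ℤ.+ d) ℤ.+ b ℤ.* (x ℤ.* z ℤ.+ e)
  lemma = ℤSolver.solve-∀

dot-zeroˡ : (z : Vector ℤ n) → dot (λ _ → 0ℤ) z ≡ 0ℤ
dot-zeroˡ {zero}  z = ≡.refl
dot-zeroˡ {suc n} z = ≡.trans (ℤ.+-identityˡ _) (dot-zeroˡ (z ∘ suc))

-- Subgroups of ℤ^n. Vectors are functions, so `resp` takes the place of function extensionality.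
record Lattice (Λ : Vector ℤ n → Set₁) : Set₁ where
  field
    resp   : ∀ {y z} → (∀ i → y i ≡ z i) → Λ y → Λ z
    zeros  : Λ (λ _ → 0ℤ)
    linear : ∀ a b {y z} → Λ y → Λ z → Λ (λ i → a ℤ.* y i ℤ.+ b ℤ.* z i)

Annihilator Cofinite : (Vector ℤ n → Set₁) → Set₁
Annihilator {n} Λ = ∃[ x ] (∃[ i ] x i ≢ 0ℤ) × (∀ z → Λ z → dot x z ≡ 0ℤ)
Cofinite {n} Λ = ∃[ p ] p ≢ 0ℤ × (∀ (z : Vector ℤ n) → Λ (λ i → p ℤ.* z i))

-- Rank below n against rank n, by elimination of the first coordinate. If some y in Λ has nonzero
-- head, then y₀ z - z₀ y has head zero for each z in Λ, which reduces Λ to its slice Λ₀. If none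
-- has, a functional is found at once: either that of Λ₀ extended by 0, or the first coordinate
-- itself.
annihilator-or-cofinite : ExcludedMiddle (lsuc 0ℓ) → {Λ : Vector ℤ n → Set₁} → Lattice Λ →
                          Annihilator Λ ⊎ Cofinite Λ
annihilator-or-cofinite {zero} em {Λ} lattice =
  inj₂ (1ℤ , (λ ()) , λ z → Lattice.resp lattice (λ ()) (Lattice.zeros lattice))
annihilator-or-cofinite {suc n} em {Λ} lattice =
  cases (annihilator-or-cofinite em tails) (em {∃[ y ] Λ y × y zero ≢ 0ℤ})
  where
  open Lattice lattice
  Λ₀ : Vector ℤ n → Set₁
  Λ₀ z = Λ (0ℤ ∷ᶠ z)
  tails : Lattice Λ₀
  tails = record
    { resp   = λ e → resp λ { zero → ≡.refl ; (suc i) → e i }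
    ; zeros  = resp (λ { zero → ≡.refl ; (suc i) → ≡.refl }) zeros
    ; linear = λ a b p q → resp (λ { zero → cong₂ ℤ._+_ (ℤ.*-zeroʳ a) (ℤ.*-zeroʳ b) ; (suc i) → ≡.refl })
                                (linear a b p q)
    }
  *-nonzero : ∀ {a b} → a ≢ 0ℤ → b ≢ 0ℤ → a ℤ.* b ≢ 0ℤ
  *-nonzero {a} a≢0 b≢0 e = [ a≢0 , b≢0 ]′ (ℤ.i*j≡0⇒i≡0∨j≡0 a e)
  cases : Annihilator Λ₀ ⊎ Cofinite Λ₀ → _ → Annihilator Λ ⊎ Cofinite Λ
  cases (inj₁ (x , (i , xᵢ≢0) , kills)) (yes (y , y∈Λ , y₀≢0)) =
    inj₁ (x′ , (suc i , *-nonzero y₀≢0 xᵢ≢0) , kills′)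
    where
    x′ : Vector ℤ (suc n)
    -- Chosen so that x′ applied to z is x applied to the tail of y₀ z - z₀ y, which belongs to the
    -- slice.
    x′ = (ℤ.- dot x (y ∘ suc)) ∷ᶠ (λ i → y zero ℤ.* x i)
    kills′ : ∀ z → Λ z → dot x′ z ≡ 0ℤ
    kills′ z z∈Λ = begin
      ℤ.- D ℤ.* z zero ℤ.+ dot (λ i → y zero ℤ.* x i) (z ∘ suc) ≡⟨ cong (λ d → ℤ.- D ℤ.* z zero ℤ.+ d) (dot-scaleˡ (y zero) x (z ∘ suc)) ⟩
      ℤ.- D ℤ.* z zero ℤ.+ y zero ℤ.* dot x (z ∘ suc)           ≡⟨ rearrange D (z zero) (y zero) _ ⟩
      y zero ℤ.* dot x (z ∘ suc) ℤ.+ ℤ.- z zero ℤ.* D           ≡⟨ dot-linear (y zero) (ℤ.- z zero) x (z ∘ suc) (y ∘ suc) ⟨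
      dot x (λ i → y zero ℤ.* z (suc i) ℤ.+ ℤ.- z zero ℤ.* y (suc i)) ≡⟨ kills _ (resp head-zero (linear (y zero) (ℤ.- z zero) z∈Λ y∈Λ)) ⟩
      0ℤ ∎
      where
      open ≡-Reasoning
      D = dot x (y ∘ suc)
      rearrange : ∀ D z y d → ℤ.- D ℤ.* z ℤ.+ y ℤ.* d ≡ y ℤ.* d ℤ.+ ℤ.- z ℤ.* D
      rearrange = ℤSolver.solve-∀
      cancels : ∀ y z → y ℤ.* z ℤ.+ ℤ.- z ℤ.* y ≡ 0ℤ
      cancels = ℤSolver.solve-∀
      head-zero : ∀ i → y zero ℤ.* z i ℤ.+ ℤ.- z zero ℤ.* y i ≡ (0ℤ ∷ᶠ (λ i → y zero ℤ.* z (suc i) ℤ.+ ℤ.- z zero ℤ.* y (suc i))) i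
      head-zero zero    = cancels (y zero) (z zero)
      head-zero (suc i) = ≡.refl
  cases (inj₂ (p , p≢0 , mem)) (yes (y , y∈Λ , y₀≢0)) =
    -- The decomposition is p y₀ z = p z₀ y + p (y₀ z - z₀ y), whose last summand has head zero.
    inj₂ (p ℤ.* y zero , *-nonzero p≢0 y₀≢0 , λ z → resp (split z)
      (linear (p ℤ.* z zero) 1ℤ y∈Λ (mem (λ i → y zero ℤ.* z (suc i) ℤ.- z zero ℤ.* y (suc i)))))
    where
    at-zero : ∀ p z y → p ℤ.* z ℤ.* y ℤ.+ 1ℤ ℤ.* 0ℤ ≡ p ℤ.* y ℤ.* z
    at-zero = ℤSolver.solve-∀
    at-suc : ∀ p z y y₀ z₀ → p ℤ.* z₀ ℤ.* y ℤ.+ 1ℤ ℤ.* (p ℤ.* (y₀ ℤ.* z ℤ.- z₀ ℤ.* y)) ≡ p ℤ.* y₀ ℤ.* z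
    at-suc = ℤSolver.solve-∀
    split : ∀ z i → p ℤ.* z zero ℤ.* y i ℤ.+ 1ℤ ℤ.* (0ℤ ∷ᶠ (λ i → p ℤ.* (y zero ℤ.* z (suc i) ℤ.- z zero ℤ.* y (suc i)))) i
                    ≡ p ℤ.* y zero ℤ.* z i
    split z zero    = at-zero p (z zero) (y zero)
    split z (suc i) = at-suc p (z (suc i)) (y (suc i)) (y zero) (z zero)
  cases ih (no none) = inj₁ (heads-vanish ih)
    where
    head≡0 : ∀ z → Λ z → z zero ≡ 0ℤ
    head≡0 z z∈Λ = decidable-stable (z zero ℤ.≟ 0ℤ) (λ ne → none (z , z∈Λ , ne))
    heads-vanish : Annihilator Λ₀ ⊎ Cofinite Λ₀ → Annihilator Λ
    heads-vanish (inj₁ (x , (i , xᵢ≢0) , kills)) = 0ℤ ∷ᶠ x , (suc i , xᵢ≢0) , λ z z∈Λ →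
      ≡.trans (ℤ.+-identityˡ _)
        (kills (z ∘ suc) (resp (λ { zero → head≡0 z z∈Λ ; (suc i) → ≡.refl }) z∈Λ))
    heads-vanish (inj₂ _) = 1ℤ ∷ᶠ (λ _ → 0ℤ) , (zero , λ ()) , λ z z∈Λ →
      cong₂ ℤ._+_ (≡.trans (ℤ.*-identityˡ (z zero)) (head≡0 z z∈Λ)) (dot-zeroˡ (z ∘ suc))

-- Exponent vectors and weights of words

δ : Fin n → Fin n → ℕ
δ zero    zero    = 1
δ zero    (suc j) = 0
δ (suc i) zero    = 0
δ (suc i) (suc j) = δ i j

count : Word n → Fin n → ℕ
count []      j = 0
count (i ∷ w) j = δ i j + count w j

δ-refl : (i : Fin n) → δ i i ≡ 1
δ-refl zero    = ≡.refl
δ-refl (suc i) = δ-refl i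

δ≢0⇒≡ : (i j : Fin n) → δ i j ≢ 0 → i ≡ j
δ≢0⇒≡ zero    zero    _ = ≡.refl
δ≢0⇒≡ zero    (suc j) h = ⊥-elim (h ≡.refl)
δ≢0⇒≡ (suc i) zero    h = ⊥-elim (h ≡.refl)
δ≢0⇒≡ (suc i) (suc j) h = cong suc (δ≢0⇒≡ i j h)

count-++ : ∀ (u v : Word n) j → count (u ++ v) j ≡ count u j + count v j
count-++ []      v j = ≡.refl
count-++ (i ∷ u) v j = ≡.trans (cong (δ i j +_) (count-++ u v j)) (≡.sym (ℕ.+-assoc (δ i j) _ _))

count-replicate : ∀ p (i j : Fin n) → count (replicate p i) j ≡ p * δ i j
count-replicate zero    i j = ≡.refl
count-replicate (suc p) i j = cong (δ i j +_) (count-replicate p i j)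

count≢0⇒∈ : ∀ (w : Word n) i → count w i ≢ 0 → i ∈ w
count≢0⇒∈ []      i h = ⊥-elim (h ≡.refl)
count≢0⇒∈ (j ∷ w) i h with δ j i ℕ.≟ 0
... | yes e = there (count≢0⇒∈ w i (λ e′ → h (cong₂ _+_ e e′)))
... | no ne = here (≡.sym (δ≢0⇒≡ j i ne))

count-↭ : ∀ (u v : Word n) → (∀ i → count u i ≡ count v i) → u ↭ v
count-↭ [] []      e = ↭-refl
count-↭ [] (i ∷ v) e with () ← ≡.trans (e i) (cong (_+ count v i) (δ-refl i))
count-↭ (i ∷ u) v e
  with ys , zs , ≡.refl ← ∈-∃++ (count≢0⇒∈ v i
         (λ v₀ → ℕ.1+n≢0 (≡.trans (cong (_+ count u i) (≡.sym (δ-refl i))) (≡.trans (e i) v₀)))) =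
  ↭-trans (↭.prep i (count-↭ u (ys ++ zs) λ j → ℕ.+-cancelˡ-≡ (δ i j) _ _ (≡.trans (e j) (moved j))))
          (↭-sym (shift i ys zs))
  where
  open ≡-Reasoning
  moved : ∀ j → count (ys ++ i ∷ zs) j ≡ δ i j + count (ys ++ zs) j
  moved j = begin
    count (ys ++ i ∷ zs) j                      ≡⟨ count-++ ys (i ∷ zs) j ⟩
    count ys j + (δ i j + count zs j)       ≡⟨ ℕ.+-assoc (count ys j) _ _ ⟨
    count ys j + δ i j + count zs j         ≡⟨ cong (_+ count zs j) (ℕ.+-comm (count ys j) _) ⟩
    δ i j + count ys j + count zs j         ≡⟨ ℕ.+-assoc (δ i j) _ _ ⟩
    δ i j + (count ys j + count zs j)       ≡⟨ cong (δ i j +_) (count-++ ys zs j) ⟨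
    δ i j + count (ys ++ zs) j                ∎

infix 8 _^ʷ_
_^ʷ_ : Word n → ℕ → Word n
w ^ʷ k = concat (replicate k w)

count-^ : ∀ (w : Word n) k j → count (w ^ʷ k) j ≡ k * count w j
count-^ w zero    j = ≡.refl
count-^ w (suc k) j = ≡.trans (count-++ w (w ^ʷ k) j) (cong (count w j +_) (count-^ w k j))

weight : Vector ℤ n → Word n → ℤ
weight x = foldr (λ i z → x i ℤ.+ z) 0ℤ

weight-++ : ∀ (x : Vector ℤ n) u v → weight x (u ++ v) ≡ weight x u ℤ.+ weight x v
weight-++ x []      v = ≡.sym (ℤ.+-identityˡ _)
weight-++ x (i ∷ u) v = ≡.trans (cong (λ c → x i ℤ.+ c) (weight-++ x u v)) (≡.sym (ℤ.+-assoc (x i) _ _))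

weight-^ : ∀ (x : Vector ℤ n) w k → weight x (w ^ʷ k) ≡ ℤ.+ k ℤ.* weight x w
weight-^ x w zero    = ≡.sym (ℤ.*-zeroˡ (weight x w))
weight-^ x w (suc k) = ≡.trans (weight-++ x w (w ^ʷ k))
  (≡.trans (cong (λ c → weight x w ℤ.+ c) (weight-^ x w k)) (≡.sym (ℤ.suc-* (ℤ.+ k) (weight x w))))

weight-replicate : ∀ (x : Vector ℤ n) k i → weight x (replicate k i) ≡ ℤ.+ k ℤ.* x i
weight-replicate x zero    i = ≡.sym (ℤ.*-zeroˡ (x i))
weight-replicate x (suc k) i = ≡.trans (cong (λ c → x i ℤ.+ c) (weight-replicate x k i)) (≡.sym (ℤ.suc-* (ℤ.+ k) (x i)))

dot-δ : ∀ (x : Vector ℤ n) i → dot x (λ j → ℤ.+ δ i j) ≡ x i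
dot-δ x zero    = ≡.trans (cong₂ ℤ._+_ (ℤ.*-identityʳ (x zero)) (dot-zeroʳ (x ∘ suc))) (ℤ.+-identityʳ (x zero))
  where
  dot-zeroʳ : ∀ {n} (x : Vector ℤ n) → dot x (λ _ → 0ℤ) ≡ 0ℤ
  dot-zeroʳ {zero}  x = ≡.refl
  dot-zeroʳ {suc n} x = cong₂ ℤ._+_ (ℤ.*-zeroʳ (x zero)) (dot-zeroʳ (x ∘ suc))
dot-δ x (suc i) = ≡.trans (cong₂ ℤ._+_ (ℤ.*-zeroʳ (x zero)) (dot-δ (x ∘ suc) i)) (ℤ.+-identityˡ _)

dot-count : ∀ (x : Vector ℤ n) w → dot x (λ j → ℤ.+ count w j) ≡ weight x w
-- The zero vector is written as a combination with coefficients 0, so that linearity evaluates it.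
dot-count x []      = ≡.trans (dot-congʳ x {z = λ _ → 0ℤ ℤ.* 0ℤ ℤ.+ 0ℤ ℤ.* 0ℤ} (λ _ → ≡.refl)) (dot-linear 0ℤ 0ℤ x (λ _ → 0ℤ) (λ _ → 0ℤ))
dot-count x (i ∷ w) = begin
  dot x (λ j → ℤ.+ (δ i j + count w j))                 ≡⟨ dot-congʳ x (λ j → ≡.sym (cong₂ ℤ._+_ (ℤ.*-identityˡ (ℤ.+ δ i j)) (ℤ.*-identityˡ (ℤ.+ count w j)))) ⟩
  dot x (λ j → 1ℤ ℤ.* ℤ.+ δ i j ℤ.+ 1ℤ ℤ.* ℤ.+ count w j)         ≡⟨ dot-linear 1ℤ 1ℤ x (λ j → ℤ.+ δ i j) (λ j → ℤ.+ count w j) ⟩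
  1ℤ ℤ.* dot x (λ j → ℤ.+ δ i j) ℤ.+ 1ℤ ℤ.* dot x (λ j → ℤ.+ count w j) ≡⟨ cong₂ ℤ._+_ (ℤ.*-identityˡ (dot x (λ j → ℤ.+ δ i j))) (ℤ.*-identityˡ (dot x (λ j → ℤ.+ count w j))) ⟩
  dot x (λ j → ℤ.+ δ i j) ℤ.+ dot x (λ j → ℤ.+ count w j)     ≡⟨ cong₂ ℤ._+_ (dot-δ x i) (dot-count x w) ⟩
  x i ℤ.+ weight x w ∎
  where open ≡-Reasoning

module Character (em : ExcludedMiddle (lsuc 0ℓ)) {n : ℕ} (V : Variety n)
  (bijective : GeneralizedBijective V) (commutative : Commutative V) where
  open Variety-theory em V bijective commutative

  ++-cong : ∀ {u u′ v v′} → u ≋ u′ → v ≋ v′ → u ++ v ≋ u′ ++ v′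
  ++-cong {u′ = u′} {v = v} p q = ≋-trans (++-congˡ v p) (++-congʳ u′ q)

  ^-cong : ∀ k {u v} → u ≋ v → u ^ʷ k ≋ v ^ʷ k
  ^-cong zero    p = ≋-refl
  ^-cong (suc k) p = ++-cong p (^-cong k p)

  -- Relations u ≋ v, read as the exponent vectors of u / v.
  Relations : Vector ℤ n → Set₁
  Relations z = ∃[ u ] ∃[ v ] u ≋ v × (∀ i → z i ℤ.+ ℤ.+ count v i ≡ ℤ.+ count u i)

  private
    scale : ∀ c {z} → Relations z → Relations (λ i → c ℤ.* z i)
    scale (ℤ.+ k) {z} (u , v , u≋v , e) = u ^ʷ k , v ^ʷ k , ^-cong k u≋v , λ i → begin
      ℤ.+ k ℤ.* z i ℤ.+ ℤ.+ count (v ^ʷ k) i    ≡⟨ cong (λ c → ℤ.+ k ℤ.* z i ℤ.+ ℤ.+ c) (count-^ v k i) ⟩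
      ℤ.+ k ℤ.* z i ℤ.+ ℤ.+ (k * count v i)   ≡⟨ cong (λ c → ℤ.+ k ℤ.* z i ℤ.+ c) (ℤ.pos-* k (count v i)) ⟩
      ℤ.+ k ℤ.* z i ℤ.+ ℤ.+ k ℤ.* ℤ.+ count v i     ≡⟨ ℤ.*-distribˡ-+ (ℤ.+ k) (z i) (ℤ.+ count v i) ⟨
      ℤ.+ k ℤ.* (z i ℤ.+ ℤ.+ count v i)         ≡⟨ cong (ℤ.+ k ℤ.*_) (e i) ⟩
      ℤ.+ k ℤ.* ℤ.+ count u i                 ≡⟨ ℤ.pos-* k (count u i) ⟨
      ℤ.+ (k * count u i)               ≡⟨ cong ℤ.+_ (count-^ u k i) ⟨
      ℤ.+ count (u ^ʷ k) i                ∎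
      where open ≡-Reasoning
    -- A negative multiple exchanges the two sides of the relation.
    scale ℤ.-[1+ k ] {z} (u , v , u≋v , e) = v ^ʷ suc k , u ^ʷ suc k , ≋-sym (^-cong (suc k) u≋v) , λ i → begin
      ℤ.- ℤ.+ K ℤ.* z i ℤ.+ ℤ.+ count (u ^ʷ K) i          ≡⟨ cong (λ c → ℤ.- ℤ.+ K ℤ.* z i ℤ.+ ℤ.+ c) (count-^ u K i) ⟩
      ℤ.- ℤ.+ K ℤ.* z i ℤ.+ ℤ.+ (K * count u i)         ≡⟨ cong (λ c → ℤ.- ℤ.+ K ℤ.* z i ℤ.+ c) (ℤ.pos-* K (count u i)) ⟩
      ℤ.- ℤ.+ K ℤ.* z i ℤ.+ ℤ.+ K ℤ.* ℤ.+ count u i           ≡⟨ cong (λ c → ℤ.- ℤ.+ K ℤ.* z i ℤ.+ ℤ.+ K ℤ.* c) (e i) ⟨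
      ℤ.- ℤ.+ K ℤ.* z i ℤ.+ ℤ.+ K ℤ.* (z i ℤ.+ ℤ.+ count v i)   ≡⟨ simplify (ℤ.+ K) (z i) (ℤ.+ count v i) ⟩
      ℤ.+ K ℤ.* ℤ.+ count v i                         ≡⟨ ℤ.pos-* K (count v i) ⟨
      ℤ.+ (K * count v i)                       ≡⟨ cong ℤ.+_ (count-^ v K i) ⟨
      ℤ.+ count (v ^ʷ K) i                        ∎
      where
      open ≡-Reasoning
      K = suc k
      simplify : ∀ K z c → ℤ.- K ℤ.* z ℤ.+ K ℤ.* (z ℤ.+ c) ≡ K ℤ.* c
      simplify = ℤSolver.solve-∀

    add : ∀ {y z} → Relations y → Relations z → Relations (λ i → y i ℤ.+ z i)
    add {y} {z} (u , v , u≋v , e) (u′ , v′ , u′≋v′ , e′) = u ++ u′ , v ++ v′ , ++-cong u≋v u′≋v′ , λ i → begin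
      y i ℤ.+ z i ℤ.+ ℤ.+ count (v ++ v′) i             ≡⟨ cong (λ c → y i ℤ.+ z i ℤ.+ ℤ.+ c) (count-++ v v′ i) ⟩
      y i ℤ.+ z i ℤ.+ (ℤ.+ count v i ℤ.+ ℤ.+ count v′ i)    ≡⟨ interchange (y i) (z i) (ℤ.+ count v i) (ℤ.+ count v′ i) ⟩
      (y i ℤ.+ ℤ.+ count v i) ℤ.+ (z i ℤ.+ ℤ.+ count v′ i)  ≡⟨ cong₂ ℤ._+_ (e i) (e′ i) ⟩
      ℤ.+ count u i ℤ.+ ℤ.+ count u′ i                  ≡⟨ cong ℤ.+_ (count-++ u u′ i) ⟨
      ℤ.+ count (u ++ u′) i                         ∎
      where
      open ≡-Reasoning
      interchange : ∀ a b c d → a ℤ.+ b ℤ.+ (c ℤ.+ d) ≡ (a ℤ.+ c) ℤ.+ (b ℤ.+ d)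
      interchange = ℤSolver.solve-∀

  relations : Lattice Relations
  relations = record
    { resp   = λ e (u , v , p , f) → u , v , p , λ i → ≡.trans (cong (ℤ._+ ℤ.+ count v i) (≡.sym (e i))) (f i)
    ; zeros  = [] , [] , ≋-refl , λ _ → ≡.refl
    ; linear = λ a b {y} {z} p q → add {λ i → a ℤ.* y i} {λ i → b ℤ.* z i} (scale a {y} p) (scale b {z} q)
    }

  annihilator-character : ∀ x → (∀ z → Relations z → dot x z ≡ 0ℤ) → ∀ {u v} → u ≋ v → weight x u ≡ weight x v
  annihilator-character x kills {u} {v} u≋v = ℤ.i-j≡0⇒i≡j _ _ (begin
    weight x u ℤ.- weight x v                                   ≡⟨ cong₂ ℤ._-_ (dot-count x u) (dot-count x v) ⟨
    dot x cu ℤ.- dot x cv                                       ≡⟨ expand (dot x cu) (dot x cv) ⟩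
    1ℤ ℤ.* dot x cu ℤ.+ ℤ.- 1ℤ ℤ.* dot x cv                           ≡⟨ dot-linear 1ℤ (ℤ.- 1ℤ) x cu cv ⟨
    dot x (λ i → 1ℤ ℤ.* cu i ℤ.+ ℤ.- 1ℤ ℤ.* cv i)                     ≡⟨ kills _ (u , v , u≋v , λ i → collapse (cu i) (cv i)) ⟩
    0ℤ                                                        ∎)
    where
    open ≡-Reasoning
    cu cv : Vector ℤ n
    cu i = ℤ.+ count u i
    cv i = ℤ.+ count v i
    expand : ∀ a b → a ℤ.- b ≡ 1ℤ ℤ.* a ℤ.+ ℤ.- 1ℤ ℤ.* b
    expand = ℤSolver.solve-∀
    collapse : ∀ a b → 1ℤ ℤ.* a ℤ.+ ℤ.- 1ℤ ℤ.* b ℤ.+ b ≡ a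
    collapse = ℤSolver.solve-∀

  -- For p ≥ 0, comparing exponents shows that i^p v is a permutation of u; since u ≋ v, the word v
  -- cancels. For negative p the roles of u and v are exchanged.
  torsion : ∀ p i → Relations (λ j → p ℤ.* ℤ.+ δ i j) → replicate ∣ p ∣ i ≋ []
  torsion (ℤ.+ k) i (u , v , u≋v , e) = ++-cancelʳ v (≋-trans (↭⇒≋ (count-↭ _ u λ j → begin
    count (replicate k i ++ v) j            ≡⟨ count-++ (replicate k i) v j ⟩
    count (replicate k i) j + count v j   ≡⟨ cong (_+ count v j) (count-replicate k i j) ⟩
    k * δ i j + count v j               ≡⟨ ℤ.+-injective (≡.trans (cong (ℤ._+ ℤ.+ count v j) (ℤ.pos-* k (δ i j))) (e j)) ⟩
    count u j                               ∎)) u≋v)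
    where open ≡-Reasoning
  torsion ℤ.-[1+ k ] i (u , v , u≋v , e) = ++-cancelʳ u (≋-trans (↭⇒≋ (count-↭ _ v λ j → begin
    count (replicate K i ++ u) j            ≡⟨ count-++ (replicate K i) u j ⟩
    count (replicate K i) j + count u j   ≡⟨ cong (_+ count u j) (count-replicate K i j) ⟩
    K * δ i j + count u j               ≡⟨ ℤ.+-injective (≡.trans (cong (ℤ._+ ℤ.+ count u j) (ℤ.pos-* K (δ i j))) (begin
      ℤ.+ K ℤ.* ℤ.+ δ i j ℤ.+ ℤ.+ count u j                               ≡⟨ cong (λ c → ℤ.+ K ℤ.* ℤ.+ δ i j ℤ.+ c) (e j) ⟨
      ℤ.+ K ℤ.* ℤ.+ δ i j ℤ.+ (ℤ.- ℤ.+ K ℤ.* ℤ.+ δ i j ℤ.+ ℤ.+ count v j)           ≡⟨ simplify (ℤ.+ K) (ℤ.+ δ i j) (ℤ.+ count v j) ⟩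
      ℤ.+ count v j                                               ∎)) ⟩
    count v j                               ∎)) (≋-sym u≋v))
    where
    open ≡-Reasoning
    K = suc k
    simplify : ∀ K d c → K ℤ.* d ℤ.+ (ℤ.- K ℤ.* d ℤ.+ c) ≡ c
    simplify = ℤSolver.solve-∀

  private
    -- Normal forms of words when every letter has order dividing p: one block per letter, with
    -- exponents below p.
    representatives : ℕ → List (Fin n) → List (Word n)
    representatives p []       = [] ∷ []
    representatives p (i ∷ is) = cartesianProductWith (λ e w → replicate e i ++ w) (upTo p) (representatives p is)

    -- The new letter commutes past the other blocks to its own.
    absorb : ∀ p .{{_ : NonZero p}} → (∀ i → replicate p i ≋ []) → ∀ {i is} → i ∈ is →
             ∀ {w} → w ∈ representatives p is → ∃[ w′ ] w′ ∈ representatives p is × i ∷ w ≋ w′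
    absorb p@(suc p-1) tors {i} {j ∷ is} i∈ w∈
      with e , w , e∈ , w′∈ , ≡.refl ← ∈-cartesianProductWith⁻ _ (upTo p) (representatives p is) w∈ with i∈
    ... | there i∈is with w″ , w″∈ , iw≋ ← absorb p tors i∈is w′∈ =
      replicate e j ++ w″ , ∈-cartesianProductWith⁺ _ e∈ w″∈ ,
      ≋-trans (↭⇒≋ (↭-sym (shift i (replicate e j) w))) (++-congʳ (replicate e j) iw≋)
    ... | here ≡.refl with suc e ℕ.<? p
    ... | yes e+1<p = replicate (suc e) j ++ w , ∈-cartesianProductWith⁺ _ (∈-upTo⁺ e+1<p) w′∈ , ≋-refl
    -- The block has reached length exactly p and vanishes, leaving exponent 0.
    ... | no  e+1≮p with ≡.refl ← ℕ.≤-antisym (∈-upTo⁻ e∈) (ℕ.≮⇒≥ e+1≮p) =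
      w , ∈-cartesianProductWith⁺ _ (∈-upTo⁺ {p} (s≤s z≤n)) w′∈ , ++-congˡ w (tors j)

    representative : ∀ p .{{_ : NonZero p}} → (∀ i → replicate p i ≋ []) → ∀ w →
                     ∃[ w′ ] w′ ∈ representatives p (allFin n) × w ≋ w′
    representative p@(suc _) tors [] = [] , []∈ (allFin n) , ≋-refl
      where
      []∈ : ∀ is → [] ∈ representatives p is
      []∈ []       = here ≡.refl
      []∈ (i ∷ is) = ∈-cartesianProductWith⁺ (λ e w → replicate e i ++ w) (∈-upTo⁺ {p} (s≤s z≤n)) ([]∈ is)
    representative p tors (i ∷ w) with w′ , w′∈ , w≋ ← representative p tors w
      with w″ , w″∈ , iw≋ ← absorb p tors (∈-allFin i) w′∈ =
      w″ , w″∈ , ≋-trans (++-congʳ (i ∷ []) w≋) iw≋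

  torsion⇒finite : ∀ p .{{_ : NonZero p}} → (∀ i → replicate p i ≋ []) → ¬ Infinite (Free V 1)
  torsion⇒finite p tors infinite = infinite
    ( map (λ w → act w (atom zero)) (representatives p (allFin n))
    , λ t → let w′ , w′∈ , w≋ = representative p tors (word t) in
        Any.map⁺ (Any.map (λ { ≡.refl → subst (_≈ act w′ (atom zero)) (≡.sym (single t)) (≋⇒≈ w≋ (atom zero)) }) w′∈))
    where
    open FreeStructure infinite {1}
    single : ∀ t → t ≡ act (word t) (atom zero)
    single (atom zero) = ≡.refl
    single (app i t)   = cong (app i) (single t)

  character : Infinite (Free V 1) →
    ∃[ x ] (∃[ i ] x i ≢ 0ℤ) × (∀ {u v} → u ≋ v → weight x u ≡ weight x v)
  character infinite with annihilator-or-cofinite em relations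
  ... | inj₁ (x , nonzero , kills) = x , nonzero , annihilator-character x kills
  ... | inj₂ (p , p≢0 , mem) = ⊥-elim
    (torsion⇒finite ∣ p ∣ {{ℕ.≢-nonZero (p≢0 ∘ ℤ.∣i∣≡0⇒i≡0)}}
      (λ i → torsion p i (mem (λ j → ℤ.+ δ i j))) infinite)

-- Presentations with a far shift

^ʷ-+ : (w : Word n) (k l : ℕ) → w ^ʷ (k + l) ≡ w ^ʷ k ++ w ^ʷ l
^ʷ-+ w zero    l = ≡.refl
^ʷ-+ w (suc k) l = ≡.trans (cong (w ++_) (^ʷ-+ w k l)) (≡.sym (++-assoc w (w ^ʷ k) (w ^ʷ l)))

interchange-↭ : (a b c d : Word n) → (a ++ b) ++ (c ++ d) ↭ (a ++ c) ++ (b ++ d)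
interchange-↭ a b c d = ↭-trans (↭-reflexive (++-assoc a b (c ++ d)))
  (↭-trans (++⁺ˡ a (shifts b c)) (↭-reflexive (≡.sym (++-assoc a c (b ++ d)))))

weight-bound : (x : Vector ℤ n) → ∃[ X ] ∀ w → ∣ weight x w ∣ ≤ length w * X
weight-bound {n} x = let X , bound = entries x in X , words-bound X bound
  where
  entries : ∀ {n} (x : Vector ℤ n) → ∃[ X ] ∀ i → ∣ x i ∣ ≤ X
  entries {zero}  x = 0 , λ ()
  entries {suc n} x = let X , bound = entries (tail x) in ∣ head x ∣ + X ,
    λ { zero → ℕ.m≤m+n _ _ ; (suc i) → ℕ.≤-trans (bound i) (ℕ.m≤n+m _ _) }
  words-bound : ∀ X → (∀ i → ∣ x i ∣ ≤ X) → ∀ w → ∣ weight x w ∣ ≤ length w * X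
  words-bound X bound []      = z≤n
  words-bound X bound (i ∷ w) = ℕ.≤-trans (ℤ.∣i+j∣≤∣i∣+∣j∣ (x i) _) (ℕ.+-mono-≤ (bound i) (words-bound X bound w))

module Presentations (em : ExcludedMiddle (lsuc 0ℓ)) {n m : ℕ} .{{_ : NonZero m}} (V : Variety n)
  (bijective : GeneralizedBijective V) (commutative : Commutative V) (infinite : Infinite (Free V 1))
  (χ : Vector ℤ n)
  (χ-invariant : ∀ {u v} → Variety-theory._≋_ em V bijective commutative u v → weight χ u ≡ weight χ v)
  where
  open Variety-theory em V bijective commutative
  module F = FreeStructure infinite {m}

  shift-of : Identity n m → ℤ
  shift-of (p , q) = weight χ (word q) ℤ.- weight χ (word p)

  distance : ClosedTerm n m → ClosedTerm n m → ℕ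
  distance t s = ∣ weight χ (word t) ℤ.- weight χ (word s) ∣

  -- F itself is the test member: R holds in F once its two generators are sent to suitable points
  -- of a single copy of G.
  module Distinct-bases (p q : ClosedTerm n m) (p≢q : base p ≢ base q) where
    private
      P Q : Word n
      P = word p
      Q = word q
      o : ClosedTerm n m
      o = atom (base p)

    -- Under this assignment R becomes P (Q o) ≈ Q (P o), true by commutativity.
    assign : Fin m → ClosedTerm n m
    assign i with i Fin.≟ base p | i Fin.≟ base q
    ... | yes _ | _     = F.act Q o
    ... | no _  | yes _ = F.act P o
    ... | no _  | no _  = atom i

    data Assigned (i : Fin m) : ClosedTerm n m → Set where
      at-p  : i ≡ base p → Assigned i (F.act Q o)
      at-q  : i ≡ base q → Assigned i (F.act P o)
      other : i ≢ base p → i ≢ base q → Assigned i (atom i)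

    assigned : ∀ i → Assigned i (assign i)
    assigned i with i Fin.≟ base p | i Fin.≟ base q
    ... | yes i≡p | _       = at-p i≡p
    ... | no _    | yes i≡q = at-q i≡q
    ... | no i≢p  | no i≢q  = other i≢p i≢q

    assign-p : assign (base p) ≡ F.act Q o
    assign-p with assign (base p) | assigned (base p)
    ... | _ | at-p _    = ≡.refl
    ... | _ | at-q p≡q  = ⊥-elim (p≢q p≡q)
    ... | _ | other p≢p _ = ⊥-elim (p≢p ≡.refl)

    assign-q : assign (base q) ≡ F.act P o
    assign-q with assign (base q) | assigned (base q)
    ... | _ | at-p q≡p  = ⊥-elim (p≢q (≡.sym q≡p))
    ... | _ | at-q _    = ≡.refl
    ... | _ | other _ q≢q = ⊥-elim (q≢q ≡.refl)

    eval-assign : ∀ t → Structure.eval (resize F.𝔖) assign t ≡ F.act (word t) (assign (base t))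
    eval-assign t = ≡.trans (eval-resize F.𝔖 assign t) (F.eval-act assign t)

    assign-satisfies : F.act P (assign (base p)) F.≈ F.act Q (assign (base q))
    assign-satisfies = ≡.subst₂ (λ x y → F.act P x F.≈ F.act Q y)
      (≡.sym assign-p) (≡.sym assign-q) (F.act-comm P Q o)

    assign-consequence : ∀ t s → V ∪ ｛ p , q ｝ ⊢ (t , s) →
                         F.act (word t) (assign (base t)) F.≈ F.act (word s) (assign (base s))
    assign-consequence t s e = ≡.subst₂ F._≈_ (eval-assign t) (eval-assign s)
      (toWitness (e (resize F.𝔖) assign F.resize-∈V
        λ { ≡.refl → fromWitness (≡.subst₂ F._≈_ (≡.sym (eval-assign p)) (≡.sym (eval-assign q)) assign-satisfies) }))

    -- On equal generators the images cancel to `word t ≋ word s`. On different generators the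
    -- images can meet only if these are the two generators of R, and then the weights of t and s
    -- differ by exactly the shift, up to sign.
    presented⇒free : ∀ t s → V ∪ ｛ p , q ｝ ⊢ (t , s) → distance t s < ∣ shift-of (p , q) ∣ →
                     base t ≡ base s × word t ≋ word s
    presented⇒free t s e near = cases (base t Fin.≟ base s)
      where
      image-t image-s : ClosedTerm n m
      image-t = F.act (word t) (assign (base t))
      image-s = F.act (word s) (assign (base s))
      same-word : word t ++ word (assign (base t)) ≋ word s ++ word (assign (base s))
      same-word = ≡.subst₂ _≋_ (F.word-act (word t) (assign (base t))) (F.word-act (word s) (assign (base s)))
        (F.free⇒≋ image-t image-s (assign-consequence t s e))
      same-base : base (assign (base t)) ≡ base (assign (base s))
      same-base = ≡.trans (≡.sym (F.base-act (word t) (assign (base t))))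
        (≡.trans (F.free⇒base image-t image-s (assign-consequence t s e)) (F.base-act (word s) (assign (base s))))
      base-o : ∀ w → base (F.act w o) ≡ base p
      base-o w = F.base-act w o
      weight-o : ∀ w w′ → weight χ (w′ ++ word (F.act w o)) ≡ weight χ w′ ℤ.+ weight χ w
      weight-o w w′ = ≡.trans (weight-++ χ w′ (word (F.act w o)))
        (cong (λ v → weight χ w′ ℤ.+ weight χ v) (≡.trans (F.word-act w o) (++-identityʳ w)))
      far : ∀ w w′ → word t ++ word (F.act w o) ≋ word s ++ word (F.act w′ o) →
            ∣ weight χ w′ ℤ.- weight χ w ∣ ≢ ∣ shift-of (p , q) ∣
      far w w′ eq eq′ = ℕ.<-irrefl (≡.trans (cong ∣_∣ (begin
        T ℤ.- S                   ≡⟨ expand T S A ⟩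
        (T ℤ.+ A) ℤ.- (S ℤ.+ A)   ≡⟨ cong (ℤ._- (S ℤ.+ A)) (≡.trans (≡.sym (weight-o w (word t))) (≡.trans (χ-invariant eq) (weight-o w′ (word s)))) ⟩
        (S ℤ.+ B) ℤ.- (S ℤ.+ A)   ≡⟨ collapse S A B ⟩
        B ℤ.- A ∎)) eq′) near
        where
        open ≡-Reasoning
        T S A B : ℤ
        T = weight χ (word t)
        S = weight χ (word s)
        A = weight χ w
        B = weight χ w′
        expand : ∀ T S A → T ℤ.- S ≡ (T ℤ.+ A) ℤ.- (S ℤ.+ A)
        expand = ℤSolver.solve-∀
        collapse : ∀ S A B → (S ℤ.+ B) ℤ.- (S ℤ.+ A) ≡ B ℤ.- A
        collapse = ℤSolver.solve-∀
      separate : base t ≢ base s → ∀ {x y} → Assigned (base t) x → Assigned (base s) y →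
                 ¬ (base x ≡ base y × word t ++ word x ≋ word s ++ word y)
      separate t≢s (at-p t≡p)    (at-p s≡p)    _        = t≢s (≡.trans t≡p (≡.sym s≡p))
      separate t≢s (at-q t≡q)    (at-q s≡q)    _        = t≢s (≡.trans t≡q (≡.sym s≡q))
      separate t≢s (at-p _)      (at-q _)      (_ , eq) = far Q P eq (ℤ.∣i-j∣≡∣j-i∣ (weight χ P) (weight χ Q))
      separate t≢s (at-q _)      (at-p _)      (_ , eq) = far P Q eq ≡.refl
      separate t≢s (at-p _)      (other s≢p _) (eq , _) = s≢p (≡.trans (≡.sym eq) (base-o Q))
      separate t≢s (at-q _)      (other s≢p _) (eq , _) = s≢p (≡.trans (≡.sym eq) (base-o P))
      separate t≢s (other t≢p _) (at-p _)      (eq , _) = t≢p (≡.trans eq (base-o Q))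
      separate t≢s (other t≢p _) (at-q _)      (eq , _) = t≢p (≡.trans eq (base-o P))
      separate t≢s (other _ _)   (other _ _)   (eq , _) = t≢s eq
      cases : _ → base t ≡ base s × word t ≋ word s
      cases (yes t≡s) = t≡s , ++-cancelʳ (word (assign (base s)))
        (subst (λ i → word t ++ word (assign i) ≋ word s ++ word (assign (base s))) t≡s same-word)
      cases (no t≢s) = ⊥-elim (separate t≢s (assigned (base t)) (assigned (base s)) (same-base , same-word))

  module Equal-bases (p q : ClosedTerm n m) (p≡q : base p ≡ base q) where
    P Q : Word n
    P = word p
    Q = word q

    -- With inverses, equality of `mixed k l` on t and `mixed l k` on s means s = (P/Q)^(k-l) t.
    -- Exchanging the exponents on the other side avoids negative powers.
    mixed : ℕ → ℕ → Word n
    mixed k l = P ^ʷ k ++ Q ^ʷ l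

    mixed-+ : ∀ k k′ l l′ → mixed k l ++ mixed k′ l′ ↭ mixed (k + k′) (l + l′)
    mixed-+ k k′ l l′ = ↭-trans (interchange-↭ (P ^ʷ k) (Q ^ʷ l) (P ^ʷ k′) (Q ^ʷ l′))
      (↭-reflexive (≡.sym (cong₂ _++_ (^ʷ-+ P k k′) (^ʷ-+ Q l l′))))

    -- Coarser than ⟨ā|R⟩: Q / P is killed on every generator, not only on base p.
    infix 4 _∼_
    _∼_ : ClosedTerm n m → ClosedTerm n m → Set
    t ∼ s = ∃[ k ] ∃[ l ] True (em {F.act (mixed k l) t F.≈ F.act (mixed l k) s})

    act-mixed-+ : ∀ k k′ l l′ t → F.act (mixed k l) (F.act (mixed k′ l′) t) F.≈ F.act (mixed (k + k′) (l + l′)) t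
    act-mixed-+ k k′ l l′ t = subst (F._≈ F.act (mixed (k + k′) (l + l′)) t) (F.act-++ (mixed k l) (mixed k′ l′) t)
      (F.act-↭ (mixed-+ k k′ l l′) t)

    quotient : Structure n 0ℓ 0ℓ
    quotient = record
      { domain = record
        { Carrier = ClosedTerm n m
        ; _≈_ = _∼_
        ; isEquivalence = record
          { refl  = λ {x} → 0 , 0 , fromWitness (F.refl {x})
          ; sym   = λ {x} {y} (k , l , e) → l , k , fromWitness
              (F.sym {F.act (mixed k l) x} {F.act (mixed l k) y} (toWitness e))
          ; trans = λ {x} {y} {z} (k , l , e) (k′ , l′ , e′) → k + k′ , l + l′ , fromWitness
              (∼-trans x y z k l k′ l′ (toWitness e) (toWitness e′))
          }
        }
      ; fun = λ i → record
        { to   = app i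
        ; cong = λ {x} {y} (k , l , e) → k , l , fromWitness (app-cong i x y k l (toWitness e))
        }
      }
      where
      open import Relation.Binary.Reasoning.Setoid F.domain
      ∼-trans : ∀ x y z k l k′ l′ → F.act (mixed k l) x F.≈ F.act (mixed l k) y →
        F.act (mixed k′ l′) y F.≈ F.act (mixed l′ k′) z →
        F.act (mixed (k + k′) (l + l′)) x F.≈ F.act (mixed (l + l′) (k + k′)) z
      ∼-trans x y z k l k′ l′ e e′ = begin
        F.act (mixed (k + k′) (l + l′)) x         ≈⟨ act-mixed-+ k k′ l l′ x ⟨
        F.act (mixed k l) (F.act (mixed k′ l′) x)     ≈⟨ F.act-comm (mixed k l) (mixed k′ l′) x ⟩
        F.act (mixed k′ l′) (F.act (mixed k l) x)     ≈⟨ F.act-cong (mixed k′ l′) {F.act (mixed k l) x} {F.act (mixed l k) y} e ⟩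
        F.act (mixed k′ l′) (F.act (mixed l k) y)     ≈⟨ F.act-comm (mixed k′ l′) (mixed l k) y ⟩
        F.act (mixed l k) (F.act (mixed k′ l′) y)     ≈⟨ F.act-cong (mixed l k) {F.act (mixed k′ l′) y} {F.act (mixed l′ k′) z} e′ ⟩
        F.act (mixed l k) (F.act (mixed l′ k′) z)     ≈⟨ act-mixed-+ l l′ k k′ z ⟩
        F.act (mixed (l + l′) (k + k′)) z         ∎
      app-cong : ∀ i x y k l → F.act (mixed k l) x F.≈ F.act (mixed l k) y →
        F.act (mixed k l) (app i x) F.≈ F.act (mixed l k) (app i y)
      app-cong i x y k l e = begin
        F.act (mixed k l) (app i x)   ≈⟨ F.act-comm (mixed k l) (i ∷ []) x ⟩
        app i (F.act (mixed k l) x)   ≈⟨ F.act-cong (i ∷ []) {F.act (mixed k l) x} {F.act (mixed l k) y} e ⟩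
        app i (F.act (mixed l k) y)   ≈⟨ F.act-comm (i ∷ []) (mixed l k) y ⟩
        F.act (mixed l k) (app i y)   ∎

    eval-quotient : {X : Set} (ρ : X → ClosedTerm n m) (t : Term n X) → Structure.eval quotient ρ t ≡ F.eval ρ t
    eval-quotient ρ (atom _)  = ≡.refl
    eval-quotient ρ (app i t) = cong (app i) (eval-quotient ρ t)

    quotient-∈V : quotient ∈ⱽ V
    quotient-∈V {t} {u} e ρ = 0 , 0 , fromWitness
      (≡.subst₂ F._≈_ (≡.sym (eval-quotient ρ t)) (≡.sym (eval-quotient ρ u)) (F.∈V e ρ))

    eval-atom : ∀ t → Structure.eval quotient atom t ≡ t
    eval-atom (atom _)  = ≡.refl
    eval-atom (app i t) = cong (app i) (eval-atom t)

    p∼q : p ∼ q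
    -- These exponents ask for Q p = P q; both are Q P applied to the common generator.
    p∼q = 0 , 1 , fromWitness (begin
      F.act (mixed 0 1) p                ≈⟨ F.act-↭ (↭-reflexive (++-identityʳ Q)) p ⟩
      F.act Q p                          ≡⟨ cong (F.act Q) (F.canonical p) ⟩
      F.act Q (F.act P (atom (base p)))  ≈⟨ F.act-comm Q P (atom (base p)) ⟩
      F.act P (F.act Q (atom (base p)))  ≡⟨ cong (λ b → F.act P (F.act Q (atom b))) p≡q ⟩
      F.act P (F.act Q (atom (base q)))  ≡⟨ cong (F.act P) (F.canonical q) ⟨
      F.act P q                          ≈⟨ F.act-↭ (↭-reflexive (≡.trans (++-identityʳ (P ++ [])) (++-identityʳ P))) q ⟨
      F.act (mixed 1 0) q                ∎)
      where open import Relation.Binary.Reasoning.Setoid F.domain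

    push : ∀ t s → V ∪ ｛ p , q ｝ ⊢ (t , s) → t ∼ s
    push t s e = ≡.subst₂ _∼_ (eval-atom t) (eval-atom s)
      (e quotient atom quotient-∈V λ { ≡.refl → ≡.subst₂ _∼_ (≡.sym (eval-atom p)) (≡.sym (eval-atom q)) p∼q })

    -- Weights in the equation defining `t ∼ s` give χ(t) - χ(s) = (k - l) times the shift. Being
    -- smaller than the shift, the difference forces k = l, and the same mixed word cancels on both
    -- sides.
    presented⇒free : ∀ t s → V ∪ ｛ p , q ｝ ⊢ (t , s) → distance t s < ∣ shift-of (p , q) ∣ →
                     base t ≡ base s × word t ≋ word s
    presented⇒free t s e near = let k , l , w = push t s e in go k l (toWitness w)
      where
      go : ∀ k l → F.act (mixed k l) t F.≈ F.act (mixed l k) s → base t ≡ base s × word t ≋ word s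
      go k l e = bases , ++-cancelˡ (mixed k k)
        (subst (λ j → mixed k j ++ word t ≋ mixed j k ++ word s) (≡.sym k≡l) words)
        where
        bases : base t ≡ base s
        bases = ≡.trans (≡.sym (F.base-act (mixed k l) t)) (≡.trans (F.free⇒base (F.act (mixed k l) t) (F.act (mixed l k) s) e) (F.base-act (mixed l k) s))
        words : mixed k l ++ word t ≋ mixed l k ++ word s
        words = ≡.subst₂ _≋_ (F.word-act (mixed k l) t) (F.word-act (mixed l k) s)
          (F.free⇒≋ (F.act (mixed k l) t) (F.act (mixed l k) s) e)
        weight-mixed : ∀ k l w → weight χ (mixed k l ++ w) ≡ ℤ.+ k ℤ.* weight χ P ℤ.+ ℤ.+ l ℤ.* weight χ Q ℤ.+ weight χ w
        weight-mixed k l w = ≡.trans (weight-++ χ (mixed k l) w) (cong (ℤ._+ weight χ w)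
          (≡.trans (weight-++ χ (P ^ʷ k) (Q ^ʷ l)) (cong₂ ℤ._+_ (weight-^ χ P k) (weight-^ χ Q l))))
        difference : weight χ (word t) ℤ.- weight χ (word s) ≡ (ℤ.+ k ℤ.- ℤ.+ l) ℤ.* shift-of (p , q)
        difference = begin
          T ℤ.- S                                               ≡⟨ expand T S (ℤ.+ k) (ℤ.+ l) WP WQ ⟩
          (ℤ.+ k ℤ.* WP ℤ.+ ℤ.+ l ℤ.* WQ ℤ.+ T) ℤ.- (ℤ.+ k ℤ.* WP ℤ.+ ℤ.+ l ℤ.* WQ ℤ.+ S)
            ≡⟨ cong (ℤ._- (ℤ.+ k ℤ.* WP ℤ.+ ℤ.+ l ℤ.* WQ ℤ.+ S))
                 (≡.trans (≡.sym (weight-mixed k l (word t))) (≡.trans (χ-invariant words) (weight-mixed l k (word s)))) ⟩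
          (ℤ.+ l ℤ.* WP ℤ.+ ℤ.+ k ℤ.* WQ ℤ.+ S) ℤ.- (ℤ.+ k ℤ.* WP ℤ.+ ℤ.+ l ℤ.* WQ ℤ.+ S) ≡⟨ collapse S (ℤ.+ k) (ℤ.+ l) WP WQ ⟩
          (ℤ.+ k ℤ.- ℤ.+ l) ℤ.* (WQ ℤ.- WP) ∎
          where
          open ≡-Reasoning
          T = weight χ (word t)
          S = weight χ (word s)
          WP = weight χ P
          WQ = weight χ Q
          expand : ∀ T S k l P Q → T ℤ.- S ≡ (k ℤ.* P ℤ.+ l ℤ.* Q ℤ.+ T) ℤ.- (k ℤ.* P ℤ.+ l ℤ.* Q ℤ.+ S)
          expand = ℤSolver.solve-∀
          collapse : ∀ S k l P Q → (l ℤ.* P ℤ.+ k ℤ.* Q ℤ.+ S) ℤ.- (k ℤ.* P ℤ.+ l ℤ.* Q ℤ.+ S) ≡ (k ℤ.- l) ℤ.* (Q ℤ.- P)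
          collapse = ℤSolver.solve-∀
        k≡l : k ≡ l
        k≡l with ∣ ℤ.+ k ℤ.- ℤ.+ l ∣ in eq
        ... | zero  = ℤ.+-injective (ℤ.i-j≡0⇒i≡j (ℤ.+ k) (ℤ.+ l) (ℤ.∣i∣≡0⇒i≡0 eq))
        ... | suc d = ⊥-elim (ℕ.<⇒≱ near (ℕ.≤-trans (ℕ.m≤m+n _ _) (ℕ.≤-reflexive (≡.sym
                (≡.trans (cong ∣_∣ difference) (≡.trans (ℤ.abs-* (ℤ.+ k ℤ.- ℤ.+ l) (shift-of (p , q)))
                  (cong (_* ∣ shift-of (p , q) ∣) eq)))))))

  presented⇒free : ∀ R t s → V ∪ ｛ R ｝ ⊢ (t , s) → distance t s < ∣ shift-of R ∣ →
                   base t ≡ base s × word t ≋ word s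
  presented⇒free (p , q) with base p Fin.≟ base q
  ... | yes e = Equal-bases.presented⇒free p q e
  ... | no ne = Distinct-bases.presented⇒free p q ne

  module _ (h : Fin n) (h≢0 : χ h ≢ 0ℤ) where

    powers-distinct : ∀ {i j} → replicate i h ≋ replicate j h → i ≡ j
    powers-distinct {i} {j} e = ℤ.+-injective (ℤ.*-cancelʳ-≡ (ℤ.+ i) (ℤ.+ j) (χ h) {{ℤ.≢-nonZero h≢0}}
      (≡.trans (≡.sym (weight-replicate χ i h)) (≡.trans (χ-invariant e) (weight-replicate χ j h))))

    open Game em {n} {m} _≋_ h (λ {i} {j} → powers-distinct {i} {j})

    presented : Pred (Identity n m) 0ℓ → Pointed
    presented S = record
      { structure = 𝔖
      ; constants = atom
      ; commutingBijections = commutingBijections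
      ; ≋⇒≈ = ≋⇒≈
      }
      where open Presented S

    free-upTo : ∀ L → Pointed.FreeUpTo (presented ∅) L
    free-upTo L t u v _ _ e = ++-cancelʳ (word t)
      (≡.subst₂ _≋_ (F.word-act u t) (F.word-act v t) (F.free⇒≋ (F.act u t) (F.act v t) e))

    -- The game tests only words of length at most `radius φ`. Once the shift exceeds every
    -- difference of weights of two such words, each equation it can meet in ⟨ā|R⟩ already holds in
    -- F; the converse is automatic, as ⟨ā|R⟩ satisfies all equations of F.
    presented-agrees : (φ : Sentence n m) →
      ∃[ C ] ∀ R → C < ∣ shift-of R ∣ → FreeSatisfies V φ ⇔ PresentedSatisfies V R φ
    presented-agrees φ = threshold , λ R far → mk⇔
      (transfer φ ℕ.≤-refl 𝔉 (presented ｛ R ｝) (free-upTo reach) (presented-upTo R far) (forth R) (back R far))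
      (transfer φ ℕ.≤-refl (presented ｛ R ｝) 𝔉 (presented-upTo R far) (free-upTo reach) (back R far) (forth R))
      where
      𝔉 : Pointed
      𝔉 = presented ∅
      reach slope threshold : ℕ
      reach = radius φ
      slope = proj₁ (weight-bound χ)
      -- Twice the largest possible weight of a word of length `reach`.
      threshold = reach * slope + reach * slope
      close : ∀ u v → length u ≤ reach → length v ≤ reach → ∣ weight χ u ℤ.- weight χ v ∣ ≤ threshold
      close u v lu lv = ℕ.≤-trans (ℤ.∣i-j∣≤∣i∣+∣j∣ (weight χ u) (weight χ v)) (ℕ.+-mono-≤ (bound u lu) (bound v lv))
        where
        bound : ∀ w → length w ≤ reach → ∣ weight χ w ∣ ≤ reach * slope
        bound w l = ℕ.≤-trans (proj₂ (weight-bound χ) w) (ℕ.*-monoˡ-≤ slope l)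
      near : ∀ R → threshold < ∣ shift-of R ∣ → ∀ u v → length u ≤ reach → length v ≤ reach → ∀ t s → weight χ (word t) ≡ weight χ (word s) →
             distance (F.act u t) (F.act v s) < ∣ shift-of R ∣
      near R far u v lu lv t s eq = ℕ.≤-<-trans (ℕ.≤-trans (ℕ.≤-reflexive (cong ∣_∣ (begin
        weight χ (word (F.act u t)) ℤ.- weight χ (word (F.act v s)) ≡⟨ cong₂ (λ a b → weight χ a ℤ.- weight χ b) (F.word-act u t) (F.word-act v s) ⟩
        weight χ (u ++ word t) ℤ.- weight χ (v ++ word s)           ≡⟨ cong₂ ℤ._-_ (weight-++ χ u (word t)) (weight-++ χ v (word s)) ⟩
        (weight χ u ℤ.+ weight χ (word t)) ℤ.- (weight χ v ℤ.+ weight χ (word s)) ≡⟨ cong (λ a → (weight χ u ℤ.+ a) ℤ.- (weight χ v ℤ.+ weight χ (word s))) eq ⟩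
        (weight χ u ℤ.+ weight χ (word s)) ℤ.- (weight χ v ℤ.+ weight χ (word s)) ≡⟨ collapse (weight χ u) (weight χ v) (weight χ (word s)) ⟩
        weight χ u ℤ.- weight χ v ∎))) (close u v lu lv)) far
        where
        open ≡-Reasoning
        collapse : ∀ a b c → (a ℤ.+ c) ℤ.- (b ℤ.+ c) ≡ a ℤ.- b
        collapse = ℤSolver.solve-∀
      presented-upTo : ∀ R → threshold < ∣ shift-of R ∣ → Pointed.FreeUpTo (presented ｛ R ｝) reach
      presented-upTo R far t u v lu lv e = ++-cancelʳ (word t)
        (≡.subst₂ _≋_ (F.word-act u t) (F.word-act v t)
          (proj₂ (presented⇒free R (F.act u t) (F.act v t) e (near R far u v lu lv t t ≡.refl))))
      forth : ∀ R → Preserves reach 𝔉 (presented ｛ R ｝) []ᶠ []ᶠ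
      forth R (inj₁ i) (inj₁ j) u v lu lv e 𝔐 a h s = e 𝔐 a h λ ()
      back : ∀ R → threshold < ∣ shift-of R ∣ → Preserves reach (presented ｛ R ｝) 𝔉 []ᶠ []ᶠ
      back R far (inj₁ i) (inj₁ j) u v lu lv e =
        ≡.subst₂ F._≈_ (≡.sym (F.canonical t)) (≡.sym (≡.trans (F.canonical s) (cong (λ b → F.act (word s) (atom b)) (≡.sym bases))))
          (F.≋⇒≈ words (atom (base t)))
        where
        t s : ClosedTerm n m
        t = F.act u (atom i)
        s = F.act v (atom j)
        both = presented⇒free R t s e (near R far u v lu lv (atom i) (atom j) ≡.refl)
        bases = proj₁ both
        words = proj₂ both

-- Counting identities with a small shift

private variable
  A B C : Set

unique⇒length≤ : {xs ys : List A} → Unique xs → (∀ {x} → x ∈ xs → x ∈ ys) → length xs ≤ length ys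
unique⇒length≤ [] sub = z≤n
unique⇒length≤ {xs = x ∷ xs} (x∉ ∷ u) sub with ys₁ , ys₂ , ≡.refl ← ∈-∃++ (sub (here ≡.refl)) =
  ℕ.≤-trans (s≤s (unique⇒length≤ u sub′)) (ℕ.≤-reflexive (begin
    suc (length (ys₁ ++ ys₂))         ≡⟨ cong suc (length-++ ys₁) ⟩
    suc (length ys₁ + length ys₂)     ≡⟨ ℕ.+-suc (length ys₁) (length ys₂) ⟨
    length ys₁ + suc (length ys₂)     ≡⟨ length-++ ys₁ ⟨
    length (ys₁ ++ x ∷ ys₂)           ∎))
  where
  open ≡-Reasoning
  sub′ : ∀ {y} → y ∈ xs → y ∈ ys₁ ++ ys₂
  sub′ y∈ with ∈-++⁻ ys₁ (sub (there y∈))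
  ... | inj₁ p         = ∈-++⁺ˡ p
  ... | inj₂ (here e)  = ⊥-elim (All.lookup x∉ y∈ (≡.sym e))
  ... | inj₂ (there p) = ∈-++⁺ʳ ys₁ p

∑ : List A → (A → ℕ) → ℕ
∑ xs f = sum (map f xs)

∑-cong : (xs : List A) {f g : A → ℕ} → (∀ x → f x ≡ g x) → ∑ xs f ≡ ∑ xs g
∑-cong []       e = ≡.refl
∑-cong (x ∷ xs) e = cong₂ _+_ (e x) (∑-cong xs e)

∑-mono : (xs : List A) {f g : A → ℕ} → (∀ x → f x ≤ g x) → ∑ xs f ≤ ∑ xs g
∑-mono []       e = z≤n
∑-mono (x ∷ xs) e = ℕ.+-mono-≤ (e x) (∑-mono xs e)

∑-const : (xs : List A) (c : ℕ) → ∑ xs (const c) ≡ length xs * c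
∑-const []       c = ≡.refl
∑-const (x ∷ xs) c = cong (c +_) (∑-const xs c)

∑-+ : (xs : List A) (f g : A → ℕ) → ∑ xs (λ x → f x + g x) ≡ ∑ xs f + ∑ xs g
∑-+ []       f g = ≡.refl
∑-+ (x ∷ xs) f g rewrite ∑-+ xs f g = lemma (f x) (g x) (∑ xs f) (∑ xs g)
  where
  lemma : ∀ a b c d → a + b + (c + d) ≡ a + c + (b + d)
  lemma = ℕSolver.solve-∀

∑-*ˡ : (xs : List A) (c : ℕ) (f : A → ℕ) → ∑ xs (λ x → c * f x) ≡ c * ∑ xs f
∑-*ˡ []       c f = ≡.sym (ℕ.*-zeroʳ c)
∑-*ˡ (x ∷ xs) c f rewrite ∑-*ˡ xs c f = ≡.sym (ℕ.*-distribˡ-+ c (f x) _)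

∑-swap : (xs : List A) (ys : List B) (f : A → B → ℕ) → ∑ xs (λ x → ∑ ys (f x)) ≡ ∑ ys (λ y → ∑ xs (λ x → f x y))
∑-swap []       ys f = ≡.sym (≡.trans (∑-const ys 0) (ℕ.*-zeroʳ (length ys)))
∑-swap (x ∷ xs) ys f rewrite ∑-swap xs ys f = ≡.sym (∑-+ ys (f x) (λ y → ∑ xs (λ x → f x y)))

∑-++ : (xs ys : List A) (f : A → ℕ) → ∑ (xs ++ ys) f ≡ ∑ xs f + ∑ ys f
∑-++ xs ys f = ≡.trans (cong sum (map-++ f xs ys)) (sum-++ (map f xs) (map f ys))

∑-map : (xs : List A) (g : A → B) (f : B → ℕ) → ∑ (map g xs) f ≡ ∑ xs (f ∘ g)
∑-map xs g f = cong sum (≡.sym (map-∘ xs))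

∑-cartesianProductWith : (g : A → B → C) (xs : List A) (ys : List B) (f : C → ℕ) →
  ∑ (cartesianProductWith g xs ys) f ≡ ∑ xs (λ x → ∑ ys (λ y → f (g x y)))
∑-cartesianProductWith g []       ys f = ≡.refl
∑-cartesianProductWith g (x ∷ xs) ys f =
  ≡.trans (∑-++ (map (g x) ys) _ f) (cong₂ _+_ (∑-map ys (g x) f) (∑-cartesianProductWith g xs ys f))

-- A saving of M - r at the single entry a survives in the whole sum; it is stated additively to
-- avoid truncated subtraction.
∑-singled-out : {xs : List A} {a : A} → a ∈ xs → (g : A → ℕ) (N M r : ℕ) →
  (∀ x → g x ≤ N) → g a + M ≤ N + r → ∑ xs g + M ≤ length xs * N + r
∑-singled-out {xs = x ∷ xs} (here ≡.refl) g N M r g≤ ga≤ = begin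
  g x + ∑ xs g + M            ≡⟨ swap₂₃ (g x) (∑ xs g) M ⟩
  g x + M + ∑ xs g            ≤⟨ ℕ.+-mono-≤ ga≤ (ℕ.≤-trans (∑-mono xs g≤) (ℕ.≤-reflexive (∑-const xs N))) ⟩
  N + r + length xs * N       ≡⟨ swap₂₃ N r (length xs * N) ⟩
  N + length xs * N + r       ∎
  where
  open ℕ.≤-Reasoning
  swap₂₃ : ∀ a b c → a + b + c ≡ a + c + b
  swap₂₃ = ℕSolver.solve-∀
∑-singled-out {xs = x ∷ xs} (there a∈) g N M r g≤ ga≤ = begin
  g x + ∑ xs g + M            ≡⟨ ℕ.+-assoc (g x) _ _ ⟩
  g x + (∑ xs g + M)          ≤⟨ ℕ.+-mono-≤ (g≤ x) (∑-singled-out a∈ g N M r g≤ ga≤) ⟩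
  N + (length xs * N + r)     ≡⟨ ℕ.+-assoc N _ _ ⟨
  N + length xs * N + r       ∎
  where open ℕ.≤-Reasoning

∑< : ℕ → (ℕ → ℕ) → ℕ
∑< N g = sum (applyUpTo g N)

∑<-+ : ∀ M N g → ∑< (M + N) g ≡ ∑< M g + ∑< N (λ k → g (M + k))
∑<-+ zero    N g = ≡.refl
∑<-+ (suc M) N g = ≡.trans (cong (g 0 +_) (∑<-+ M N (g ∘ suc))) (≡.sym (ℕ.+-assoc (g 0) _ _))

∑<-suc : ∀ N g → ∑< (suc N) g ≡ ∑< N g + g N
∑<-suc zero    g = ℕ.+-comm (g 0) 0
∑<-suc (suc N) g = ≡.trans (cong (g 0 +_) (∑<-suc N (g ∘ suc))) (≡.sym (ℕ.+-assoc (g 0) _ _))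

∑<-mono : ∀ N {g h : ℕ → ℕ} → (∀ {k} → k < N → g k ≤ h k) → ∑< N g ≤ ∑< N h
∑<-mono zero    le = z≤n
∑<-mono (suc N) le = ℕ.+-mono-≤ (le (s≤s z≤n)) (∑<-mono N (le ∘ s≤s))

∑<-cong : ∀ N {g h : ℕ → ℕ} → (∀ {k} → k < N → g k ≡ h k) → ∑< N g ≡ ∑< N h
∑<-cong zero    e = ≡.refl
∑<-cong (suc N) e = cong₂ _+_ (e (s≤s z≤n)) (∑<-cong N (e ∘ s≤s))

∑<-const : ∀ N c → ∑< N (const c) ≡ N * c
∑<-const zero    c = ≡.refl
∑<-const (suc N) c = cong (c +_) (∑<-const N c)

∑<-∑ : ∀ N (xs : List A) (g : ℕ → A → ℕ) → ∑< N (λ k → ∑ xs (g k)) ≡ ∑ xs (λ x → ∑< N (λ k → g k x))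
∑<-∑ zero    xs g = ≡.sym (≡.trans (∑-const xs 0) (ℕ.*-zeroʳ (length xs)))
∑<-∑ (suc N) xs g = ≡.trans (cong (∑ xs (g 0) +_) (∑<-∑ N xs (g ∘ suc))) (≡.sym (∑-+ xs (g 0) _))

∑<-add : ∀ N (g h : ℕ → ℕ) → ∑< N (λ k → g k + h k) ≡ ∑< N g + ∑< N h
∑<-add zero    g h = ≡.refl
∑<-add (suc N) g h rewrite ∑<-add N (g ∘ suc) (h ∘ suc) = lemma (g 0) (h 0) _ _
  where
  lemma : ∀ x y c d → x + y + (c + d) ≡ x + c + (y + d)
  lemma = ℕSolver.solve-∀

∑<-*ˡ : ∀ N c (g : ℕ → ℕ) → ∑< N (λ k → c * g k) ≡ c * ∑< N g
∑<-*ˡ zero    c g = ≡.sym (ℕ.*-zeroʳ c)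
∑<-*ˡ (suc N) c g rewrite ∑<-*ˡ N c (g ∘ suc) = ≡.sym (ℕ.*-distribˡ-+ c (g 0) _)

∑<-swap : ∀ M N (g : ℕ → ℕ → ℕ) → ∑< M (λ k → ∑< N (g k)) ≡ ∑< N (λ j → ∑< M (λ k → g k j))
∑<-swap zero    N g = ≡.sym (≡.trans (∑<-const N 0) (ℕ.*-zeroʳ N))
∑<-swap (suc M) N g = ≡.trans (cong (∑< N (g 0) +_) (∑<-swap M N (g ∘ suc)))
  (≡.sym (∑<-add N (g 0) (λ j → ∑< M (λ k → g (suc k) j))))

-- The frequency estimate

terms : (n m k : ℕ) → List (ClosedTerm n m)
terms n m zero    = map atom (allFin m)
terms n m (suc k) = cartesianProductWith app (allFin n) (terms n m k)

-- The number of pairs of terms of sizes k and l ∸ k, which does not depend on k.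
pairs : (n m l : ℕ) → ℕ
pairs n m l = m * m * n ^ l

∑-terms-const : ∀ k c → ∑ (terms n m k) (const c) ≡ m * n ^ k * c
∑-terms-const {n} {m} zero c = ≡.trans (∑-map (allFin m) atom (const c))
  (≡.trans (∑-const (allFin m) c) (cong (_* c) (≡.trans (length-tabulate _) (≡.sym (ℕ.*-identityʳ m)))))
∑-terms-const {n} {m} (suc k) c = begin
  ∑ (terms n m (suc k)) (const c)                      ≡⟨ ∑-cartesianProductWith app (allFin n) (terms n m k) (const c) ⟩
  ∑ (allFin n) (λ _ → ∑ (terms n m k) (const c))       ≡⟨ ∑-cong (allFin n) (λ _ → ∑-terms-const {n} {m} k c) ⟩
  ∑ (allFin n) (const (m * n ^ k * c))                 ≡⟨ ∑-const (allFin n) _ ⟩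
  length (allFin n) * (m * n ^ k * c)                  ≡⟨ cong (_* (m * n ^ k * c)) (length-tabulate {n = n} (λ i → i)) ⟩
  n * (m * n ^ k * c)                                  ≡⟨ lemma n m (n ^ k) c ⟩
  m * (n * n ^ k) * c                                  ∎
  where
  open ≡-Reasoning
  lemma : ∀ n m p c → n * (m * p * c) ≡ m * (n * p) * c
  lemma = ℕSolver.solve-∀

∑∑-terms-const : ∀ k l c → ∑ (terms n m k) (λ _ → ∑ (terms n m l) (const c)) ≡ pairs n m (k + l) * c
∑∑-terms-const {n} {m} k l c = ≡.trans (∑-cong (terms n m k) (λ _ → ∑-terms-const {n} {m} l c))
  (≡.trans (∑-terms-const {n} {m} k _) (≡.trans (lemma m (n ^ k) (n ^ l) c)
    (cong (λ p → m * m * p * c) (≡.sym (ℕ.^-distribˡ-+-* n k l)))))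
  where
  lemma : ∀ m a b c → m * a * (m * b * c) ≡ m * m * (a * b) * c
  lemma = ℕSolver.solve-∀

module Counting {n m : ℕ} (χ : Vector ℤ n) (f : ℤ → ℕ) where

  χ′ : ClosedTerm n m → ℤ
  χ′ t = weight χ (word t)

  -- A letter in front of either term moves the difference of weights. The offset y records such
  -- moves, and the recursion closes only because it treats all offsets at once.
  count₂ : ℕ → ℕ → ℤ → ℕ
  count₂ k l y = ∑ (terms n m k) λ t → ∑ (terms n m l) λ s → f (y ℤ.+ (χ′ s ℤ.- χ′ t))

  count₂-sucˡ : ∀ k l y → count₂ (suc k) l y ≡ ∑ (allFin n) λ i → count₂ k l (y ℤ.- χ i)
  count₂-sucˡ k l y = ≡.trans (∑-cartesianProductWith app (allFin n) (terms n m k) _)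
    (∑-cong (allFin n) λ i → ∑-cong (terms n m k) λ t → ∑-cong (terms n m l) λ s →
      cong f (lemma y (χ i) (χ′ t) (χ′ s)))
    where
    lemma : ∀ y x t s → y ℤ.+ (s ℤ.- (x ℤ.+ t)) ≡ (y ℤ.- x) ℤ.+ (s ℤ.- t)
    lemma = ℤSolver.solve-∀

  count₂-sucʳ : ∀ k l y → count₂ k (suc l) y ≡ ∑ (allFin n) λ i → count₂ k l (y ℤ.+ χ i)
  count₂-sucʳ k l y = ≡.trans
    (∑-cong (terms n m k) λ t → ≡.trans (∑-cartesianProductWith app (allFin n) (terms n m l) _)
      (∑-cong (allFin n) λ i → ∑-cong (terms n m l) λ s → cong f (lemma y (χ i) (χ′ t) (χ′ s))))
    (∑-swap (terms n m k) (allFin n) _)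
    where
    lemma : ∀ y x t s → y ℤ.+ ((x ℤ.+ s) ℤ.- t) ≡ (y ℤ.+ x) ℤ.+ (s ℤ.- t)
    lemma = ℤSolver.solve-∀

  -- The pairs obtained from the pairs of total size l by putting j letters in
  -- front of the first term and j′ letters in front of the second.
  stretched : ℕ → ℕ → ℕ → ℤ → ℕ
  stretched j j′ l y = ∑< (suc l) λ k → count₂ (j + k) (j′ + (l ∸ k)) y

  countₗ : ℕ → ℤ → ℕ
  countₗ = stretched 0 0

  stretched-sucˡ : ∀ j j′ l y → stretched (suc j) j′ l y ≡ ∑ (allFin n) λ i → stretched j j′ l (y ℤ.- χ i)
  stretched-sucˡ j j′ l y = ≡.trans (∑<-cong (suc l) λ {k} _ → count₂-sucˡ (j + k) (j′ + (l ∸ k)) y)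
    (∑<-∑ (suc l) (allFin n) λ k i → count₂ (j + k) (j′ + (l ∸ k)) (y ℤ.- χ i))

  stretched-sucʳ : ∀ j j′ l y → stretched j (suc j′) l y ≡ ∑ (allFin n) λ i → stretched j j′ l (y ℤ.+ χ i)
  stretched-sucʳ j j′ l y = ≡.trans (∑<-cong (suc l) λ {k} _ → count₂-sucʳ (j + k) (j′ + (l ∸ k)) y)
    (∑<-∑ (suc l) (allFin n) λ k i → count₂ (j + k) (j′ + (l ∸ k)) (y ℤ.+ χ i))

  module _ (a : Fin n) where

    -- The offset reached when all j + j′ new letters are a.
    target : ℕ → ℕ → ℤ → ℤ
    target j j′ y = y ℤ.+ (ℤ.+ j′ ℤ.* χ a ℤ.- ℤ.+ j ℤ.* χ a)

    -- Among the n ^ (j + j′) ways to stretch, the one using the letter a only is counted apart.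
    module Stretch (q l M : ℕ) (bound : ∀ y → q * countₗ l y ≤ M) where

      -- A new letter splits the count into n counts with moved offsets. Each is crudely at most
      -- n^(j + j′) M, and the branch of a keeps its refined bound; the crude bound itself follows
      -- from the refined one at the same j and j′.
      stretched-bound : ∀ j j′ y → q * stretched j j′ l y + M ≤ n ^ (j + j′) * M + q * countₗ l (target j j′ y)

      private
        stretched≤ : ∀ j j′ y → q * stretched j j′ l y ≤ n ^ (j + j′) * M
        stretched≤ j j′ y = ℕ.+-cancelʳ-≤ M _ _
          (ℕ.≤-trans (stretched-bound j j′ y) (ℕ.+-monoʳ-≤ (n ^ (j + j′) * M) (bound (target j j′ y))))

        step : ∀ j j′ (y : Fin n → ℤ) z → target j j′ (y a) ≡ z →
          q * ∑ (allFin n) (λ i → stretched j j′ l (y i)) + M ≤ n ^ suc (j + j′) * M + q * countₗ l z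
        step j j′ y z ≡.refl = begin
          q * ∑ (allFin n) (λ i → stretched j j′ l (y i)) + M     ≡⟨ cong (_+ M) (∑-*ˡ (allFin n) q (λ i → stretched j j′ l (y i))) ⟨
          ∑ (allFin n) (λ i → q * stretched j j′ l (y i)) + M
            ≤⟨ ∑-singled-out (∈-allFin a) _ (n ^ (j + j′) * M) M _ (λ i → stretched≤ j j′ (y i)) (stretched-bound j j′ (y a)) ⟩
          length (allFin n) * (n ^ (j + j′) * M) + q * countₗ l z ≡⟨ cong (λ c → c * (n ^ (j + j′) * M) + q * countₗ l z) (length-tabulate {n = n} (λ i → i)) ⟩
          n * (n ^ (j + j′) * M) + q * countₗ l z                 ≡⟨ cong (_+ q * countₗ l z) (ℕ.*-assoc n (n ^ (j + j′)) M) ⟨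
          n ^ suc (j + j′) * M + q * countₗ l z                   ∎
          where open ℕ.≤-Reasoning

      stretched-bound zero zero y = ℕ.≤-reflexive (≡.trans (ℕ.+-comm _ M)
        (cong₂ _+_ (≡.sym (ℕ.*-identityˡ M)) (cong (λ z → q * countₗ l z) (lemma y (χ a)))))
        where
        lemma : ∀ y x → y ≡ y ℤ.+ (0ℤ ℤ.* x ℤ.- 0ℤ ℤ.* x)
        lemma = ℤSolver.solve-∀
      stretched-bound zero (suc j′) y rewrite stretched-sucʳ 0 j′ l y = step 0 j′ (λ i → y ℤ.+ χ i) _
        (≡.trans (lemma y (χ a) (ℤ.+ j′)) (cong (λ z → y ℤ.+ (z ℤ.- 0ℤ ℤ.* χ a)) (≡.sym (ℤ.suc-* (ℤ.+ j′) (χ a)))))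
        where
        lemma : ∀ y x j → (y ℤ.+ x) ℤ.+ (j ℤ.* x ℤ.- 0ℤ ℤ.* x) ≡ y ℤ.+ ((x ℤ.+ j ℤ.* x) ℤ.- 0ℤ ℤ.* x)
        lemma = ℤSolver.solve-∀
      stretched-bound (suc j) j′ y rewrite stretched-sucˡ j j′ l y = step j j′ (λ i → y ℤ.- χ i) _
        (≡.trans (lemma y (χ a) (ℤ.+ j) (ℤ.+ j′)) (cong (λ z → y ℤ.+ (ℤ.+ j′ ℤ.* χ a ℤ.- z)) (≡.sym (ℤ.suc-* (ℤ.+ j) (χ a)))))
        where
        lemma : ∀ y x j j′ → (y ℤ.- x) ℤ.+ (j′ ℤ.* x ℤ.- j ℤ.* x) ≡ y ℤ.+ (j′ ℤ.* x ℤ.- (x ℤ.+ j ℤ.* x))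
        lemma = ℤSolver.solve-∀

    module Bounded (f≤1 : ∀ y → f y ≤ 1) where

      private
        W : ℕ → ℕ
        W = pairs n m

      count₂≤ : ∀ k l y → count₂ k l y ≤ W (k + l)
      count₂≤ k l y = ℕ.≤-trans (∑-mono (terms n m k) λ t → ∑-mono (terms n m l) λ s → f≤1 _)
        (ℕ.≤-reflexive (≡.trans (∑∑-terms-const {n} {m} k l 1) (ℕ.*-identityʳ _)))

      countₗ≤ : ∀ l y → countₗ l y ≤ suc l * W l
      countₗ≤ l y = ℕ.≤-trans (∑<-mono (suc l) λ {k} k<1+l → ℕ.≤-trans (count₂≤ k (l ∸ k) y)
          (ℕ.≤-reflexive (cong W (ℕ.m+[n∸m]≡n (ℕ.s≤s⁻¹ k<1+l)))))
        (ℕ.≤-reflexive (∑<-const (suc l) (W l)))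

      -- A pair is not a stretch only if its first term is shorter than j or its second shorter than
      -- j′. This concerns j + j′ ways to split the length, with at most W pairs each.
      countₗ-stretched : ∀ j j′ l y → countₗ (j + j′ + l) y ≤ stretched j j′ l y + (j + j′) * W (j + j′ + l)
      countₗ-stretched j j′ l y = begin
        ∑< (suc l⁺) g                                                ≡⟨ cong (λ N → ∑< N g) (reorder j j′ l) ⟩
        ∑< (j + (suc l + j′)) g                                     ≡⟨ ∑<-+ j (suc l + j′) g ⟩
        ∑< j g + ∑< (suc l + j′) (g ∘ (j +_))                       ≡⟨ cong (∑< j g +_) (∑<-+ (suc l) j′ (g ∘ (j +_))) ⟩
        ∑< j g + (∑< (suc l) (g ∘ (j +_)) + ∑< j′ (λ k → g (j + (suc l + k))))
          ≤⟨ ℕ.+-mono-≤ low (ℕ.+-mono-≤ (ℕ.≤-reflexive middle) high) ⟩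
        j * W l⁺ + (stretched j j′ l y + j′ * W l⁺)                   ≡⟨ collect j j′ (W l⁺) (stretched j j′ l y) ⟩
        stretched j j′ l y + (j + j′) * W l⁺ ∎
        where
        open ℕ.≤-Reasoning
        l⁺ : ℕ
        l⁺ = j + j′ + l
        g : ℕ → ℕ
        g k = count₂ k (l⁺ ∸ k) y
        reorder : ∀ j j′ l → suc (j + j′ + l) ≡ j + (suc l + j′)
        reorder = ℕSolver.solve-∀
        collect : ∀ j j′ w s → j * w + (s + j′ * w) ≡ s + (j + j′) * w
        collect = ℕSolver.solve-∀
        g≤ : ∀ {k} → k ≤ l⁺ → g k ≤ W l⁺
        g≤ {k} k≤l⁺ = ℕ.≤-trans (count₂≤ k (l⁺ ∸ k) y) (ℕ.≤-reflexive (cong W (ℕ.m+[n∸m]≡n k≤l⁺)))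
        low : ∑< j g ≤ j * W l⁺
        low = ℕ.≤-trans (∑<-mono j λ k<j → g≤ (ℕ.≤-trans (ℕ.<⇒≤ k<j) (ℕ.≤-trans (ℕ.m≤m+n j j′) (ℕ.m≤m+n (j + j′) l))))
          (ℕ.≤-reflexive (∑<-const j (W l⁺)))
        high : ∑< j′ (λ k → g (j + (suc l + k))) ≤ j′ * W l⁺
        high = ℕ.≤-trans (∑<-mono j′ λ {k} k<j′ → g≤ (ℕ.s≤s⁻¹
            (ℕ.≤-trans (ℕ.+-monoʳ-< j (ℕ.+-monoʳ-< (suc l) k<j′)) (ℕ.≤-reflexive (≡.sym (reorder j j′ l))))))
          (ℕ.≤-reflexive (∑<-const j′ (W l⁺)))
        middle : ∑< (suc l) (g ∘ (j +_)) ≡ stretched j j′ l y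
        middle = ∑<-cong (suc l) λ {k} k<1+l → cong (λ r → count₂ (j + k) r y) (begin-equality
          (j + j′ + l) ∸ (j + k)    ≡⟨ cong (_∸ (j + k)) (ℕ.+-assoc j j′ l) ⟩
          (j + (j′ + l)) ∸ (j + k)  ≡⟨ ℕ.[m+n]∸[m+o]≡n∸o j (j′ + l) k ⟩
          (j′ + l) ∸ k              ≡⟨ ℕ.+-∸-assoc j′ (ℕ.s≤s⁻¹ k<1+l) ⟩
          j′ + (l ∸ k)              ∎)

      -- `hits` limits how many of the Q + 1 places reached by powers of a are counted by f; the
      -- frequency obtained from it is about B / (Q + 1).
      module _ (Q B : ℕ) (hits : ∀ y → ∑< (suc Q) (λ j → f (target j (Q ∸ j) y)) ≤ B) where
        private
          q D : ℕ
          q = suc Q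
          D = q * (Q * n ^ Q)
          -- Chosen so that bound l implies bound (Q + l).
          bound : ℕ → ℕ
          bound l = W l * (B * suc l + D)

        -- With the sum over j moved innermost, `hits` applies to each pair of terms separately.
        ∑-countₗ-target : ∀ l y → ∑< q (λ j → countₗ l (target j (Q ∸ j) y)) ≤ B * (suc l * W l)
        ∑-countₗ-target l y = begin
          ∑< q (λ j → ∑< (suc l) (λ k → count₂ k (l ∸ k) (target j (Q ∸ j) y)))
            ≡⟨ ∑<-swap q (suc l) (λ j k → count₂ k (l ∸ k) (target j (Q ∸ j) y)) ⟩
          ∑< (suc l) (λ k → ∑< q (λ j → count₂ k (l ∸ k) (target j (Q ∸ j) y)))
            ≤⟨ ∑<-mono (suc l) (λ {k} k<1+l → at k (ℕ.s≤s⁻¹ k<1+l)) ⟩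
          ∑< (suc l) (λ k → W l * B)                                              ≡⟨ ∑<-const (suc l) (W l * B) ⟩
          suc l * (W l * B)                                                       ≡⟨ rotate (suc l) (W l) B ⟩
          B * (suc l * W l) ∎
          where
          open ℕ.≤-Reasoning
          rotate : ∀ a b c → a * (b * c) ≡ c * (a * b)
          rotate = ℕSolver.solve-∀
          at : ∀ k → k ≤ l → ∑< q (λ j → count₂ k (l ∸ k) (target j (Q ∸ j) y)) ≤ W l * B
          at k k≤l = begin
            ∑< q (λ j → count₂ k (l ∸ k) (target j (Q ∸ j) y))    ≡⟨ ∑<-∑ q (terms n m k) (λ j t → ∑ (terms n m (l ∸ k)) (F j t)) ⟩
            ∑ (terms n m k) (λ t → ∑< q (λ j → ∑ (terms n m (l ∸ k)) λ s → f (target j (Q ∸ j) y ℤ.+ (χ′ s ℤ.- χ′ t))))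
              ≤⟨ ∑-mono (terms n m k) (λ t → ℕ.≤-trans (ℕ.≤-reflexive (∑<-∑ q (terms n m (l ∸ k)) (λ j → F j t)))
                   (∑-mono (terms n m (l ∸ k)) λ s → ℕ.≤-trans
                     (ℕ.≤-reflexive (∑<-cong q λ {j} _ → cong f (move y (ℤ.+ (Q ∸ j) ℤ.* χ a ℤ.- ℤ.+ j ℤ.* χ a) (χ′ s ℤ.- χ′ t)))) (hits (y ℤ.+ (χ′ s ℤ.- χ′ t))))) ⟩
            ∑ (terms n m k) (λ _ → ∑ (terms n m (l ∸ k)) (const B)) ≡⟨ ∑∑-terms-const {n} {m} k (l ∸ k) B ⟩
            W (k + (l ∸ k)) * B                                   ≡⟨ cong (λ l → W l * B) (ℕ.m+[n∸m]≡n k≤l) ⟩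
            W l * B ∎
            where
            F : ℕ → ClosedTerm n m → ClosedTerm n m → ℕ
            F j t s = f (target j (Q ∸ j) y ℤ.+ (χ′ s ℤ.- χ′ t))
            move : ∀ y d e → (y ℤ.+ d) ℤ.+ e ≡ (y ℤ.+ e) ℤ.+ d
            move = ℤSolver.solve-∀

        -- The stretch estimates for the q choices of j are averaged. The errors are D W(l) from the
        -- boundary and B (l + 1) W(l) from the powers of a; together they are exactly `bound l`,
        -- the amount carried on the left, so what remains is n^Q `bound l`, which is at most
        -- `bound (Q + l)`.
        countₗ-step : ∀ l → (∀ y → q * countₗ l y ≤ bound l) → ∀ y → q * countₗ (Q + l) y ≤ bound (Q + l)
        countₗ-step l ih y = ℕ.+-cancelʳ-≤ (bound l) _ _ (ℕ.≤-trans (ℕ.*-cancelˡ-≤ q averaged) (begin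
          n ^ Q * bound l + q * (Q * W (Q + l)) + B * (suc l * W l)
            ≡⟨ cong (λ w → n ^ Q * bound l + q * (Q * w) + B * (suc l * W l)) W-+ ⟩
          n ^ Q * bound l + q * (Q * (n ^ Q * W l)) + B * (suc l * W l)
            ≡⟨ balance (n ^ Q) (W l) B (suc l) Q ⟩
          n ^ Q * W l * (B * suc l + D) + bound l
            ≤⟨ ℕ.+-monoˡ-≤ (bound l) (ℕ.*-monoʳ-≤ (n ^ Q * W l) (ℕ.+-monoˡ-≤ D (ℕ.*-monoʳ-≤ B (s≤s (ℕ.m≤n+m l Q))))) ⟩
          n ^ Q * W l * (B * suc (Q + l) + D) + bound l
            ≡⟨ cong (λ w → w * (B * suc (Q + l) + D) + bound l) W-+ ⟨
          bound (Q + l) + bound l ∎))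
          where
          open ℕ.≤-Reasoning
          W-+ : W (Q + l) ≡ n ^ Q * W l
          W-+ = ≡.trans (cong (m * m *_) (ℕ.^-distribˡ-+-* n Q l)) (rotate (m * m) (n ^ Q) (n ^ l))
            where
            rotate : ∀ a b c → a * (b * c) ≡ b * (a * c)
            rotate = ℕSolver.solve-∀
          balance : ∀ N w B k Q → N * (w * (B * k + suc Q * (Q * N))) + suc Q * (Q * (N * w)) + B * (k * w)
                    ≡ N * w * (B * k + suc Q * (Q * N)) + w * (B * k + suc Q * (Q * N))
          balance = ℕSolver.solve-∀
          at : ∀ {j} → j < q → q * countₗ (Q + l) y + bound l ≤
               n ^ Q * bound l + q * (Q * W (Q + l)) + q * countₗ l (target j (Q ∸ j) y)
          at {j} j<q = subst (λ R → q * countₗ (R + l) y + bound l ≤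
               n ^ R * bound l + q * (R * W (R + l)) + q * countₗ l (target j (Q ∸ j) y))
            (ℕ.m+[n∸m]≡n (ℕ.s≤s⁻¹ j<q)) (begin
              q * countₗ (j + j′ + l) y + bound l
                ≤⟨ ℕ.+-monoˡ-≤ (bound l) (ℕ.*-monoʳ-≤ q (countₗ-stretched j j′ l y)) ⟩
              q * (stretched j j′ l y + (j + j′) * W (j + j′ + l)) + bound l
                ≡⟨ spread q (stretched j j′ l y) _ (bound l) ⟩
              (q * stretched j j′ l y + bound l) + q * ((j + j′) * W (j + j′ + l))
                ≤⟨ ℕ.+-monoˡ-≤ _ (Stretch.stretched-bound q l (bound l) ih j j′ y) ⟩
              n ^ (j + j′) * bound l + q * countₗ l (target j j′ y) + q * ((j + j′) * W (j + j′ + l))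
                ≡⟨ shuffle (n ^ (j + j′) * bound l) _ _ ⟩
              n ^ (j + j′) * bound l + q * ((j + j′) * W (j + j′ + l)) + q * countₗ l (target j j′ y) ∎)
            where
            j′ : ℕ
            j′ = Q ∸ j
            spread : ∀ q s w b → q * (s + w) + b ≡ (q * s + b) + q * w
            spread = ℕSolver.solve-∀
            shuffle : ∀ a b c → a + b + c ≡ a + c + b
            shuffle = ℕSolver.solve-∀
          K : ℕ
          K = n ^ Q * bound l + q * (Q * W (Q + l))
          averaged : q * (q * countₗ (Q + l) y + bound l) ≤ q * (n ^ Q * bound l + q * (Q * W (Q + l)) + B * (suc l * W l))
          averaged = begin
            q * (q * countₗ (Q + l) y + bound l)        ≡⟨ ∑<-const q _ ⟨
            ∑< q (const (q * countₗ (Q + l) y + bound l))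
              ≤⟨ ∑<-mono q at ⟩
            ∑< q (λ j → n ^ Q * bound l + q * (Q * W (Q + l)) + q * countₗ l (target j (Q ∸ j) y))
              ≡⟨ ≡.trans (∑<-add q (const K) (λ j → q * countₗ l (target j (Q ∸ j) y)))
                   (cong (∑< q (const K) +_) (∑<-*ˡ q q (λ j → countₗ l (target j (Q ∸ j) y)))) ⟩
            ∑< q (const K) + q * ∑< q (λ j → countₗ l (target j (Q ∸ j) y))
              ≤⟨ ℕ.+-mono-≤ (ℕ.≤-reflexive (∑<-const q K)) (ℕ.*-monoʳ-≤ q (∑-countₗ-target l y)) ⟩
            q * (n ^ Q * bound l + q * (Q * W (Q + l))) + q * (B * (suc l * W l))
              ≡⟨ ℕ.*-distribˡ-+ q (n ^ Q * bound l + q * (Q * W (Q + l))) (B * (suc l * W l)) ⟨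
            q * (n ^ Q * bound l + q * (Q * W (Q + l)) + B * (suc l * W l)) ∎

        -- Induction in steps of Q. Below Q the summand D alone pays for the trivial bound, since l
        -- + 1 ≤ Q ≤ Q n^Q.
        countₗ-bound : .{{NonZero Q}} → ∀ l y → q * countₗ l y ≤ bound l
        countₗ-bound = ℕ.<-rec (λ l → ∀ y → q * countₗ l y ≤ bound l) go
          where
          instance
            n≢0 : NonZero n
            n≢0 = nonEmpty a
              where
              nonEmpty : ∀ {n} → Fin n → NonZero n
              nonEmpty {suc _} _ = _
          go : .{{NonZero Q}} → ∀ l → (∀ {k} → k < l → ∀ y → q * countₗ k y ≤ bound k) → ∀ y → q * countₗ l y ≤ bound l
          go l ih y with Q ℕ.≤? l
          ... | yes Q≤l = subst (λ l → q * countₗ l y ≤ bound l) (ℕ.m+[n∸m]≡n Q≤l)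
            (countₗ-step (l ∸ Q) (ih (ℕ.∸-monoʳ-< (ℕ.>-nonZero⁻¹ Q) Q≤l)) y)
          ... | no  Q≰l = begin
            q * countₗ l y          ≤⟨ ℕ.*-monoʳ-≤ q (countₗ≤ l y) ⟩
            q * (suc l * W l)       ≤⟨ ℕ.*-monoʳ-≤ q (ℕ.*-monoˡ-≤ (W l) (ℕ.≤-trans (ℕ.≰⇒> Q≰l) (ℕ.m≤m*n Q (n ^ Q) {{ℕ.m^n≢0 n Q}}))) ⟩
            q * (Q * n ^ Q * W l)   ≡⟨ rotate q (Q * n ^ Q) (W l) ⟩
            W l * D                 ≤⟨ ℕ.*-monoʳ-≤ (W l) (ℕ.m≤n+m D (B * suc l)) ⟩
            W l * (B * suc l + D)   ∎
            where
            open ℕ.≤-Reasoning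
            rotate : ∀ a b c → a * (b * c) ≡ c * (a * b)
            rotate = ℕSolver.solve-∀

-- Lists of identities and rarity of small shifts

𝟙 : {P : Set} → Dec P → ℕ
𝟙 d = if does d then 1 else 0

𝟙≤1 : {P : Set} (d : Dec P) → 𝟙 d ≤ 1
𝟙≤1 (yes _) = s≤s z≤n
𝟙≤1 (no _)  = z≤n

length-filter-∑ : {P : Pred A _} (P? : Decidable P) (xs : List A) → length (filter P? xs) ≡ ∑ xs (λ x → 𝟙 (P? x))
length-filter-∑ P? []       = ≡.refl
length-filter-∑ P? (x ∷ xs) with P? x
... | yes _ = cong suc (length-filter-∑ P? xs)
... | no  _ = length-filter-∑ P? xs

∑-concat-applyUpTo : ∀ (xss : ℕ → List A) N f → ∑ (concat (applyUpTo xss N)) f ≡ ∑< N (λ k → ∑ (xss k) f)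
∑-concat-applyUpTo xss zero    f = ≡.refl
∑-concat-applyUpTo xss (suc N) f =
  ≡.trans (∑-++ (xss 0) _ f) (cong (∑ (xss 0) f +_) (∑-concat-applyUpTo (xss ∘ suc) N f))

unique-concat-applyUpTo : ∀ (xss : ℕ → List A) N → (∀ k → Unique (xss k)) →
  (∀ {j k x} → x ∈ xss j → x ∈ xss k → j ≡ k) → Unique (concat (applyUpTo xss N))
unique-concat-applyUpTo xss N u key = Unique.concat⁺ (All.applyUpTo⁺₂ xss N u)
  (AllPairs.applyUpTo⁺₁ xss N λ i<j _ (p , q) → ℕ.<⇒≢ i<j (key p q))

∈-concat-applyUpTo⁺ : ∀ (xss : ℕ → List A) {N k x} → k < N → x ∈ xss k → x ∈ concat (applyUpTo xss N)
∈-concat-applyUpTo⁺ xss k<N x∈ = ∈-concat⁺′ x∈ (∈-applyUpTo⁺ xss k<N)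

∈-concat-applyUpTo⁻ : ∀ (xss : ℕ → List A) N {x} → x ∈ concat (applyUpTo xss N) → ∃[ k ] k < N × x ∈ xss k
∈-concat-applyUpTo⁻ xss N x∈ with ∈-concat⁻′ (applyUpTo xss N) x∈
... | _ , x∈xs , xs∈ with k , k<N , ≡.refl ← ∈-applyUpTo⁻ xss xs∈ = k , k<N , x∈xs

module Identities (n m : ℕ) where

  ∈-terms⁺ : (t : ClosedTerm n m) → t ∈ terms n m (size t)
  ∈-terms⁺ (atom i)  = ∈-map⁺ atom (∈-allFin i)
  ∈-terms⁺ (app i t) = ∈-cartesianProductWith⁺ app (∈-allFin i) (∈-terms⁺ t)

  ∈-terms⁻ : ∀ k {t} → t ∈ terms n m k → size t ≡ k
  ∈-terms⁻ zero t∈ with _ , _ , ≡.refl ← ∈-map⁻ atom t∈ = ≡.refl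
  ∈-terms⁻ (suc k) t∈
    with _ , _ , _ , t∈′ , ≡.refl ← ∈-cartesianProductWith⁻ app (allFin n) (terms n m k) t∈ = cong suc (∈-terms⁻ k t∈′)

  terms-unique : ∀ k → Unique (terms n m k)
  terms-unique zero    = Unique.map⁺ (λ { ≡.refl → ≡.refl }) (Unique.allFin⁺ m)
  terms-unique (suc k) = Unique.cartesianProductWith⁺ app (λ { ≡.refl → ≡.refl , ≡.refl }) (Unique.allFin⁺ n) (terms-unique k)

  identitiesOfSizes : ℕ → ℕ → List (Identity n m)
  identitiesOfSizes l k = cartesianProduct (terms n m k) (terms n m (l ∸ k))

  identitiesOfLength identitiesUpTo : ℕ → List (Identity n m)
  identitiesOfLength l = concat (applyUpTo (identitiesOfSizes l) (suc l))
  identitiesUpTo s = concat (applyUpTo identitiesOfLength (suc s))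

  private
    sizes : ∀ l k {t u} → (t , u) ∈ identitiesOfSizes l k → size t ≡ k × size u ≡ l ∸ k
    sizes l k R∈ = let t∈ , u∈ = ∈-cartesianProduct⁻ (terms n m k) (terms n m (l ∸ k)) R∈
                   in ∈-terms⁻ k t∈ , ∈-terms⁻ (l ∸ k) u∈

    ofLength⁻ : ∀ l {R} → R ∈ identitiesOfLength l → len R ≡ l
    ofLength⁻ l R∈ with k , k<1+l , R∈′ ← ∈-concat-applyUpTo⁻ (identitiesOfSizes l) (suc l) R∈
      with e , e′ ← sizes l k R∈′ = ≡.trans (cong₂ _+_ e e′) (ℕ.m+[n∸m]≡n (ℕ.s≤s⁻¹ k<1+l))

    ofLength⁺ : ∀ R → R ∈ identitiesOfLength (len R)
    ofLength⁺ (t , u) = ∈-concat-applyUpTo⁺ (identitiesOfSizes (size t + size u)) (s≤s (ℕ.m≤m+n (size t) (size u)))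
      (∈-cartesianProduct⁺ (∈-terms⁺ t) (subst (λ l → u ∈ terms n m l) (≡.sym (ℕ.m+n∸m≡n (size t) (size u))) (∈-terms⁺ u)))

    ofLength-unique : ∀ l → Unique (identitiesOfLength l)
    ofLength-unique l = unique-concat-applyUpTo (identitiesOfSizes l) (suc l)
      (λ k → Unique.cartesianProduct⁺ (terms-unique k) (terms-unique (l ∸ k)))
      (λ {j} {k} p q → ≡.trans (≡.sym (proj₁ (sizes l j p))) (proj₁ (sizes l k q)))

  identitiesUpTo⁺ : ∀ {s} R → len R ≤ s → R ∈ identitiesUpTo s
  identitiesUpTo⁺ R le = ∈-concat-applyUpTo⁺ identitiesOfLength (s≤s le) (ofLength⁺ R)

  identitiesUpTo⁻ : ∀ s {R} → R ∈ identitiesUpTo s → len R ≤ s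
  identitiesUpTo⁻ s R∈ with l , l<1+s , R∈′ ← ∈-concat-applyUpTo⁻ identitiesOfLength (suc s) R∈ =
    ℕ.≤-trans (ℕ.≤-reflexive (ofLength⁻ l R∈′)) (ℕ.s≤s⁻¹ l<1+s)

  identitiesUpTo-unique : ∀ s → Unique (identitiesUpTo s)
  identitiesUpTo-unique s = unique-concat-applyUpTo identitiesOfLength (suc s) ofLength-unique
    (λ {j} {k} p q → ≡.trans (≡.sym (ofLength⁻ j p)) (ofLength⁻ k q))

  ∑-identitiesUpTo : ∀ s (f : Identity n m → ℕ) → ∑ (identitiesUpTo s) f ≡
    ∑< (suc s) λ l → ∑< (suc l) λ k → ∑ (terms n m k) λ t → ∑ (terms n m (l ∸ k)) λ u → f (t , u)
  ∑-identitiesUpTo s f = ≡.trans (∑-concat-applyUpTo identitiesOfLength (suc s) f)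
    (∑<-cong (suc s) λ {l} _ → ≡.trans (∑-concat-applyUpTo (identitiesOfSizes l) (suc l) f)
      (∑<-cong (suc l) λ {k} _ → ∑-cartesianProductWith _,_ (terms n m k) (terms n m (l ∸ k)) f))

  length-identitiesUpTo : ∀ s → length (identitiesUpTo s) ≡ ∑< (suc s) (λ l → suc l * pairs n m l)
  length-identitiesUpTo s = begin
    length (identitiesUpTo s)              ≡⟨ ℕ.*-identityʳ _ ⟨
    length (identitiesUpTo s) * 1          ≡⟨ ∑-const (identitiesUpTo s) 1 ⟨
    ∑ (identitiesUpTo s) (const 1)         ≡⟨ ∑-identitiesUpTo s (const 1) ⟩
    ∑< (suc s) (λ l → ∑< (suc l) λ k → ∑ (terms n m k) λ _ → ∑ (terms n m (l ∸ k)) (const 1))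
      ≡⟨ ∑<-cong (suc s) (λ {l} _ → ∑<-cong (suc l) (λ {k} k<1+l →
           ≡.trans (∑∑-terms-const {n} {m} k (l ∸ k) 1) (≡.trans (ℕ.*-identityʳ _) (cong (pairs n m) (ℕ.m+[n∸m]≡n (ℕ.s≤s⁻¹ k<1+l)))))) ⟩
    ∑< (suc s) (λ l → ∑< (suc l) (const (pairs n m l)))
      ≡⟨ ∑<-cong (suc s) (λ {l} _ → ∑<-const (suc l) (pairs n m l)) ⟩
    ∑< (suc s) (λ l → suc l * pairs n m l) ∎
    where open ≡-Reasoning

-- Zero occurs twice; the length serves only as an upper bound.
window : ℕ → List ℤ
window C = applyUpTo ℤ.+_ (suc C) ++ applyUpTo (λ k → ℤ.- (ℤ.+ k)) (suc C)

∈-window : ∀ C y → ∣ y ∣ ≤ C → y ∈ window C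
∈-window C (ℤ.+ k)      le = ∈-++⁺ˡ (∈-applyUpTo⁺ ℤ.+_ (s≤s le))
∈-window C (ℤ.-[1+ k ]) le = ∈-++⁺ʳ (applyUpTo ℤ.+_ (suc C)) (∈-applyUpTo⁺ (λ k → ℤ.- (ℤ.+ k)) (s≤s le))

length-window : ∀ C → length (window C) ≡ suc C + suc C
length-window C = ≡.trans (length-++ (applyUpTo ℤ.+_ (suc C)))
  (cong₂ _+_ (length-applyUpTo ℤ.+_ (suc C)) (length-applyUpTo (λ k → ℤ.- (ℤ.+ k)) (suc C)))

∑-applyUpTo : ∀ (g : ℕ → A) N (f : A → ℕ) → ∑ (applyUpTo g N) f ≡ ∑< N (f ∘ g)
∑-applyUpTo g zero    f = ≡.refl
∑-applyUpTo g (suc N) f = cong (f (g 0) +_) (∑-applyUpTo (g ∘ suc) N f)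

-- The points y + (Q - 2j) x are distinct, so few of them lie in a window.
window-hits : ∀ C Q (x : ℤ) → x ≢ 0ℤ → ∀ y →
  ∑< (suc Q) (λ j → 𝟙 (∣ y ℤ.+ (ℤ.+ (Q ∸ j) ℤ.* x ℤ.- ℤ.+ j ℤ.* x) ∣ ℕ.≤? C)) ≤ suc C + suc C
window-hits C Q x x≢0 y = begin
  ∑< (suc Q) (λ j → 𝟙 (close? (position j)))        ≡⟨ ∑-applyUpTo position (suc Q) (𝟙 ∘ close?) ⟨
  ∑ (applyUpTo position (suc Q)) (𝟙 ∘ close?)       ≡⟨ length-filter-∑ close? (applyUpTo position (suc Q)) ⟨
  length (filter close? (applyUpTo position (suc Q)))
    ≤⟨ unique⇒length≤ (Unique.filter⁺ close? (Unique.applyUpTo⁺₁ position (suc Q) distinct))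
         (λ {z} z∈ → ∈-window C z (proj₂ (∈-filter⁻ close? {xs = applyUpTo position (suc Q)} z∈))) ⟩
  length (window C)                                 ≡⟨ length-window C ⟩
  suc C + suc C                                     ∎
  where
  open ℕ.≤-Reasoning
  position : ℕ → ℤ
  position j = y ℤ.+ (ℤ.+ (Q ∸ j) ℤ.* x ℤ.- ℤ.+ j ℤ.* x)
  close? : Decidable (λ z → ∣ z ∣ ≤ C)
  close? z = ∣ z ∣ ℕ.≤? C
  distinct : ∀ {i j} → i < j → j < suc Q → position i ≢ position j
  -- Cancelling x in an equality of positions would give (Q ∸ j) + i = (Q ∸ i) + j.
  distinct {i} {j} i<j _ e = ℕ.<⇒≢ (ℕ.+-mono-≤-< (ℕ.∸-monoʳ-≤ Q (ℕ.<⇒≤ i<j)) i<j)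
    (ℤ.+-injective (ℤ.*-cancelʳ-≡ _ _ x {{ℤ.≢-nonZero x≢0}} (≡-Reasoning.begin
      (ℤ.+ (Q ∸ j) ℤ.+ ℤ.+ i) ℤ.* x       ≡-Reasoning.≡⟨ out y x (ℤ.+ (Q ∸ j)) (ℤ.+ i) (ℤ.+ j) ⟩
      position j ℤ.+ (ℤ.+ i ℤ.* x ℤ.+ ℤ.+ j ℤ.* x ℤ.- y)
        ≡-Reasoning.≡⟨ cong (λ z → z ℤ.+ (ℤ.+ i ℤ.* x ℤ.+ ℤ.+ j ℤ.* x ℤ.- y)) e ⟨
      position i ℤ.+ (ℤ.+ i ℤ.* x ℤ.+ ℤ.+ j ℤ.* x ℤ.- y)
        ≡-Reasoning.≡⟨ back y x (ℤ.+ (Q ∸ i)) (ℤ.+ i) (ℤ.+ j) ⟩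
      (ℤ.+ (Q ∸ i) ℤ.+ ℤ.+ j) ℤ.* x       ≡-Reasoning.∎)))
    where
    out : ∀ y x a i j → (a ℤ.+ i) ℤ.* x ≡ y ℤ.+ (a ℤ.* x ℤ.- j ℤ.* x) ℤ.+ (i ℤ.* x ℤ.+ j ℤ.* x ℤ.- y)
    out = ℤSolver.solve-∀
    back : ∀ y x a i j → y ℤ.+ (a ℤ.* x ℤ.- i ℤ.* x) ℤ.+ (i ℤ.* x ℤ.+ j ℤ.* x ℤ.- y) ≡ (a ℤ.+ j) ℤ.* x
    back = ℤSolver.solve-∀

-- From l = D on, the factor l + 1 exceeds D, so each further term gains at least W(l) ≥ 1; after
-- `offset` many terms the deficit of the first D is repaid. This makes the boundary terms
-- negligible against the number of all identities.
weighted-sum-dominates : ∀ (W : ℕ → ℕ) → (∀ l → 1 ≤ W l) → ∀ D →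
  ∃[ N ] ∀ s → N ≤ s → D * ∑< s W ≤ ∑< s (λ l → suc l * W l)
weighted-sum-dominates W W≥1 D = offset + D , λ s le →
  subst (λ s → D * ∑< s W ≤ P s) (ℕ.m∸n+n≡m (ℕ.≤-trans (ℕ.m≤n+m D offset) le)) (late (s ∸ D) (ℕ.m+n≤o⇒m≤o∸n offset le))
  where
  open ℕ.≤-Reasoning
  P : ℕ → ℕ
  P s = ∑< s (λ l → suc l * W l)
  offset : ℕ
  offset = D * ∑< D W
  grow : ∀ i → D * ∑< (i + D) W + i ≤ P (i + D) + offset
  grow zero = begin
    D * ∑< D W + 0    ≡⟨ ℕ.+-identityʳ _ ⟩
    offset                 ≤⟨ ℕ.m≤n+m offset (P D) ⟩
    P D + offset           ∎
  grow (suc i) = begin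
    D * ∑< (suc (i + D)) W + suc i                        ≡⟨ cong (λ w → D * w + suc i) (∑<-suc (i + D) W) ⟩
    D * (∑< (i + D) W + W (i + D)) + suc i                ≡⟨ expand D (∑< (i + D) W) (W (i + D)) i ⟩
    (D * ∑< (i + D) W + i) + (1 + D * W (i + D))          ≤⟨ ℕ.+-mono-≤ (grow i) (ℕ.+-mono-≤ (W≥1 (i + D)) (ℕ.*-monoˡ-≤ (W (i + D)) (ℕ.m≤n+m D i))) ⟩
    (P (i + D) + offset) + suc (i + D) * W (i + D)             ≡⟨ swap₂₃ (P (i + D)) offset _ ⟩
    (P (i + D) + suc (i + D) * W (i + D)) + offset             ≡⟨ cong (_+ offset) (∑<-suc (i + D) (λ l → suc l * W l)) ⟨
    P (suc (i + D)) + offset                                   ∎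
    where
    expand : ∀ D s w i → D * (s + w) + suc i ≡ (D * s + i) + (1 + D * w)
    expand = ℕSolver.solve-∀
    swap₂₃ : ∀ a b c → a + b + c ≡ a + c + b
    swap₂₃ = ℕSolver.solve-∀
  late : ∀ i → offset ≤ i → D * ∑< (i + D) W ≤ P (i + D)
  late i offset≤i = ℕ.+-cancelʳ-≤ offset _ _ (ℕ.≤-trans (ℕ.+-monoʳ-≤ (D * ∑< (i + D) W) offset≤i) (grow i))

module Sparse {n m : ℕ} .{{m≢0 : NonZero m}} (χ : Vector ℤ n) (a : Fin n) (χa≢0 : χ a ≢ 0ℤ) (C : ℕ) where
  open Identities n m

  shift? : (R : Identity n m) → Dec (∣ weight χ (word (proj₂ R)) ℤ.- weight χ (word (proj₁ R)) ∣ ≤ C)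
  shift? R = ∣ weight χ (word (proj₂ R)) ℤ.- weight χ (word (proj₁ R)) ∣ ℕ.≤? C

  close : ℤ → ℕ
  close y = 𝟙 (∣ y ∣ ℕ.≤? C)

  open Counting {n} {m} χ close

  W : ℕ → ℕ
  W = pairs n m

  W≥1 : ∀ l → 1 ≤ W l
  W≥1 l = ℕ.*-mono-≤ {1} {m * m} {1} (ℕ.*-mono-≤ {1} {m} {1} m≥1 m≥1) (ℕ.m^n>0 n {{nonEmpty a}} l)
    where
    m≥1 : 1 ≤ m
    m≥1 = ℕ.>-nonZero⁻¹ m
    nonEmpty : ∀ {n} → Fin n → NonZero n
    nonEmpty {suc _} _ = _

  length-close : ∀ s → length (filter shift? (identitiesUpTo s)) ≡ ∑< (suc s) (λ l → countₗ l 0ℤ)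
  length-close s = ≡.trans (length-filter-∑ shift? (identitiesUpTo s)) (≡.trans (∑-identitiesUpTo s (𝟙 ∘ shift?))
    (∑<-cong (suc s) λ {l} _ → ∑<-cong (suc l) λ {k} _ → ∑-cong (terms n m k) λ t → ∑-cong (terms n m (l ∸ k)) λ u →
      cong close (≡.sym (ℤ.+-identityˡ (weight χ (word u) ℤ.- weight χ (word t))))))

  abstract
    sparse : ∀ r .{{_ : NonZero r}} → ∃[ N ] ∀ s → N ≤ s →
      r * length (filter shift? (identitiesUpTo s)) ≤ length (identitiesUpTo s)
    sparse r = N , λ s le → ℕ.*-cancelˡ-≤ (2 * K) (begin
      2 * K * (r * length (filter shift? (identitiesUpTo s)))   ≡⟨ cong (λ b → 2 * K * (r * b)) (length-close s) ⟩
      2 * K * (r * bad s)                                       ≡⟨ regroup K r (bad s) ⟩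
      2 * K * r * bad s                                         ≤⟨ ℕ.*-monoˡ-≤ (bad s) (ℕ.m≤n+m (2 * K * r) 2) ⟩
      suc Q * bad s                                             ≡⟨ ∑<-*ˡ (suc s) (suc Q) (λ l → countₗ l 0ℤ) ⟨
      ∑< (suc s) (λ l → suc Q * countₗ l 0ℤ)                    ≤⟨ ∑<-mono (suc s) (λ {l} _ → countₗ-bound′ l) ⟩
      ∑< (suc s) (λ l → W l * (K * suc l + D))                  ≡⟨ ∑<-cong (suc s) (λ {l} _ → distribute (W l) K (suc l) D) ⟩
      ∑< (suc s) (λ l → K * (suc l * W l) + D * W l)            ≡⟨ ∑<-add (suc s) (λ l → K * (suc l * W l)) (λ l → D * W l) ⟩
      ∑< (suc s) (λ l → K * (suc l * W l)) + ∑< (suc s) (λ l → D * W l)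
        ≡⟨ cong₂ _+_ (∑<-*ˡ (suc s) K (λ l → suc l * W l)) (∑<-*ˡ (suc s) D W) ⟩
      K * P s + D * ∑< (suc s) W                                ≤⟨ ℕ.+-monoʳ-≤ (K * P s) (dominated (suc s) (ℕ.m≤n⇒m≤1+n le)) ⟩
      K * P s + P s                                             ≤⟨ ℕ.+-monoʳ-≤ (K * P s) (ℕ.m≤n*m (P s) K) ⟩
      K * P s + K * P s                                         ≡⟨ double K (P s) ⟩
      2 * K * P s                                               ≡⟨ cong (2 * K *_) (length-identitiesUpTo s) ⟨
      2 * K * length (identitiesUpTo s)                         ∎)
      where
      open ℕ.≤-Reasoning
      K Q D : ℕ
      K = suc C + suc C
      -- K bounds the hits in the window. The factor 2 leaves room for the boundary terms, which for
      -- large s are at most P s and so at most K times P s; the outer `suc` makes Q visibly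
      -- nonzero.
      Q = suc (2 * K * r)
      D = suc Q * (Q * n ^ Q)
      bad P : ℕ → ℕ
      bad s = ∑< (suc s) (λ l → countₗ l 0ℤ)
      P s = ∑< (suc s) (λ l → suc l * W l)
      N : ℕ
      N = proj₁ (weighted-sum-dominates W W≥1 D)
      dominated : ∀ s → N ≤ s → D * ∑< s W ≤ ∑< s (λ l → suc l * W l)
      dominated = proj₂ (weighted-sum-dominates W W≥1 D)
      countₗ-bound′ : ∀ l → suc Q * countₗ l 0ℤ ≤ W l * (K * suc l + D)
      countₗ-bound′ l = Bounded.countₗ-bound a (λ y → 𝟙≤1 (∣ y ∣ ℕ.≤? C)) Q K (window-hits C Q (χ a) χa≢0) l 0ℤ
      regroup : ∀ K r b → 2 * K * (r * b) ≡ 2 * K * r * b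
      regroup = ℕSolver.solve-∀
      distribute : ∀ w K l D → w * (K * l + D) ≡ K * (l * w) + D * w
      distribute = ℕSolver.solve-∀
      double : ∀ K p → K * p + K * p ≡ 2 * K * p
      double = ℕSolver.solve-∀

-- Densities

length≤filters : ∀ {A : Set} {p q} {P : Pred A p} {Q : Pred A q} (P? : Decidable P) (Q? : Decidable Q) →
  (∀ x → P x ⊎ Q x) → ∀ xs → length xs ≤ length (filter P? xs) + length (filter Q? xs)
length≤filters P? Q? cover []       = z≤n
length≤filters P? Q? cover (x ∷ xs) with length≤filters P? Q? cover xs | P? x | Q? x
... | ih | yes _ | yes _ = s≤s (ℕ.≤-trans ih (ℕ.+-monoʳ-≤ _ (ℕ.n≤1+n _)))
... | ih | yes _ | no _  = s≤s ih
... | ih | no _  | yes _ = ℕ.≤-trans (s≤s ih) (ℕ.≤-reflexive (≡.sym (ℕ.+-suc _ _)))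
... | ih | no ¬p | no ¬q = ⊥-elim ([ ¬p , ¬q ]′ (cover x))

∣b/P-1∣ : ∀ b p → ℚᵘ.∣ mkℚᵘ (ℤ.+ b) p ℚᵘ.- 1ℚᵘ ∣ ≃ mkℚᵘ (ℤ.+ ℤ.∣ b ⊖ suc p ∣) p
∣b/P-1∣ b p = *≡* (cong₂ (λ x y → ℤ.+ ℤ.∣ x ∣ ℤ.* ℤ.+ y) numerator (≡.sym (ℕ.*-identityʳ (suc p))))
  where
  numerator : ℤ.+ b ℤ.* 1ℤ ℤ.+ ℤ.- 1ℤ ℤ.* ℤ.+ suc p ≡ b ⊖ suc p
  numerator = ≡.trans (cong₂ ℤ._+_ (ℤ.*-identityʳ (ℤ.+ b)) (ℤ.-1*i≡-i (ℤ.+ suc p))) (ℤ.m-n≡m⊖n b (suc p))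

near-one⁺ : ∀ b P .{{_ : NonZero P}} k d → ℤ.∣ b ⊖ P ∣ * suc d < k * P →
            ℚᵘ.∣ (ℤ.+ b) ℚᵘ./ P ℚᵘ.- 1ℚᵘ ∣ ℚᵘ.< mkℚᵘ (ℤ.+ k) d
near-one⁺ b (suc p) k d lt = ℚᵘ.<-respˡ-≃ (ℚᵘ.≃-sym (∣b/P-1∣ b p))
  (*<* (≡.subst₂ ℤ._<_ (ℤ.pos-* ℤ.∣ b ⊖ suc p ∣ (suc d)) (ℤ.pos-* k (suc p)) (ℤ.+<+ lt)))

near-one⁻ : ∀ b P .{{_ : NonZero P}} k d → ℚᵘ.∣ (ℤ.+ b) ℚᵘ./ P ℚᵘ.- 1ℚᵘ ∣ ℚᵘ.< mkℚᵘ (ℤ.+ k) d →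
            ℤ.∣ b ⊖ P ∣ * suc d < k * P
near-one⁻ b (suc p) k d lt with ℚᵘ.<-respˡ-≃ (∣b/P-1∣ b p) lt
... | *<* lt′ = ℤ.drop‿+<+ (≡.subst₂ ℤ._<_ (≡.sym (ℤ.pos-* ℤ.∣ b ⊖ suc p ∣ (suc d))) (≡.sym (ℤ.pos-* k (suc p))) lt′)

∈⇒nonEmpty : ∀ {A : Set} {x : A} {xs} → x ∈ xs → NonZero (length xs)
∈⇒nonEmpty {xs = _ ∷ _} _ = _

cardinality-≤ : ∀ {A : Set} {p q} {P : Pred A p} {Q : Pred A q} {M N} →
  HasCardinality P M → HasCardinality Q N → (∀ {x} → P x → Q x) → M ≤ N
cardinality-≤ (xs , xs! , xs⇔ , ≡.refl) (ys , ys! , ys⇔ , ≡.refl) sub =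
  unique⇒length≤ xs! (λ x∈ → Equivalence.from (ys⇔ _) (sub (Equivalence.to (xs⇔ _) x∈)))

module Density (em : ExcludedMiddle (lsuc 0ℓ)) {n m : ℕ} .{{m≢0 : NonZero m}} (V : Variety n) (φ : Sentence n m)
  (χ : Vector ℤ n) (h : Fin n) (χh≢0 : χ h ≢ 0ℤ) (C : ℕ)
  (agrees : ∀ (R : Identity n m) → C < ℤ.∣ weight χ (word (proj₂ R)) ℤ.- weight χ (word (proj₁ R)) ∣ →
            FreeSatisfies V φ ⇔ PresentedSatisfies V R φ)
  where
  open Identities n m
  open Sparse {n} {m} χ h χh≢0 C using (shift?; sparse)

  Close : Pred (Identity n m) 0ℓ
  Close (p , q) = ℤ.∣ weight χ (word q) ℤ.- weight χ (word p) ∣ ≤ C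

  satisfies? : Decidable (λ R → PresentedSatisfies V R φ)
  satisfies? R = em

  all : ∀ s → HasCardinality (λ R → len R ≤ s) (length (identitiesUpTo s))
  all s = identitiesUpTo s , identitiesUpTo-unique s , (λ R → mk⇔ (identitiesUpTo⁻ s) (identitiesUpTo⁺ R)) , ≡.refl

  filtered : ∀ {q} {Q : Pred (Identity n m) q} (Q? : Decidable Q) s →
             HasCardinality (λ R → len R ≤ s × Q R) (length (filter Q? (identitiesUpTo s)))
  filtered Q? s = filter Q? (identitiesUpTo s) , Unique.filter⁺ Q? (identitiesUpTo-unique s) ,
    (λ R → mk⇔ (λ R∈ → let R∈′ , QR = ∈-filter⁻ Q? {xs = identitiesUpTo s} R∈ in identitiesUpTo⁻ s R∈′ , QR)
               (λ (le , QR) → ∈-filter⁺ Q? (identitiesUpTo⁺ R le) QR)) , ≡.refl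

  total close satisfying : ℕ → ℕ
  total s      = length (identitiesUpTo s)
  close s      = length (filter shift? (identitiesUpTo s))
  satisfying s = length (filter satisfies? (identitiesUpTo s))

  total≢0 : ∀ s → NonZero (total s)
  total≢0 s = ∈⇒nonEmpty (identitiesUpTo⁺ {s} (atom first , atom first) z≤n)

  dense : FreeSatisfies V φ → LimitingDensity V φ 1ℚᵘ
  dense free⊨φ = total , satisfying , all , filtered satisfies? , limit
    where
    satisfying-or-close : ∀ R → PresentedSatisfies V R φ ⊎ Close R
    satisfying-or-close R with ℕ.<-≤-connex C _
    ... | inj₁ far  = inj₁ (Equivalence.to (agrees R far) free⊨φ)
    ... | inj₂ near = inj₂ near

    satisfying≤total : ∀ s → satisfying s ≤ total s
    satisfying≤total s = cardinality-≤ (filtered satisfies? s) (all s) proj₁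

    limit : ∀ ε → 0ℚᵘ ℚᵘ.< ε → ∃[ N ] ∀ s → N ≤ s →
      Σ (NonZero (total s)) λ nz → ℚᵘ.∣ ℚᵘ._/_ (ℤ.+ satisfying s) (total s) {{nz}} ℚᵘ.- 1ℚᵘ ∣ ℚᵘ.< ε
    limit (mkℚᵘ (ℤ.+ zero)   d) (*<* (ℤ.+<+ ()))
    limit (mkℚᵘ ℤ.-[1+ k ]   d) (*<* ())
    -- Here ε = (k + 1) / (d + 1) is at least 1 / (d + 1); the rate 1 / (d + 2) makes the inequality
    -- strict.
    limit (mkℚᵘ (ℤ.+ suc k)  d) _ = proj₁ (sparse (suc (suc d))) , λ s N≤s →
      total≢0 s , near-one⁺ (satisfying s) (total s) {{total≢0 s}} (suc k) d (begin-strict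
        ℤ.∣ satisfying s ⊖ total s ∣ * suc d   ≡⟨ cong (_* suc d) (ℤ.∣⊖∣-≤ (satisfying≤total s)) ⟩
        (total s ∸ satisfying s) * suc d       ≤⟨ ℕ.*-monoˡ-≤ (suc d) (ℕ.m≤n+o⇒m∸n≤o (total s) (satisfying s) (length≤filters satisfies? shift? satisfying-or-close (identitiesUpTo s))) ⟩
        close s * suc d                        <⟨ gap (close s) (total s) {{total≢0 s}} (proj₂ (sparse (suc (suc d))) s N≤s) ⟩
        total s                                ≤⟨ ℕ.m≤m+n (total s) (k * total s) ⟩
        suc k * total s                        ∎)
      where
      open ℕ.≤-Reasoning
      gap : ∀ c t .{{_ : NonZero t}} → suc (suc d) * c ≤ t → c * suc d < t
      gap zero    t le = ℕ.>-nonZero⁻¹ t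
      gap (suc c) t le = ℕ.<-≤-trans (ℕ.m<n+m (suc c * suc d) (s≤s z≤n)) (ℕ.≤-trans (ℕ.≤-reflexive (cong (suc c +_) (ℕ.*-comm (suc c) (suc d)))) le)

  -- If φ fails in F, only identities with a small shift can satisfy it, and eventually these are at
  -- most half of all, against density 1. The counts in the hypothesis are arbitrary functions,
  -- compared with the concrete lists through cardinalities.
  true-in-free : LimitingDensity V φ 1ℚᵘ → FreeSatisfies V φ
  true-in-free (P , Pφ , P-counts , Pφ-counts , limit) with em {FreeSatisfies V φ}
  ... | yes free⊨φ = free⊨φ
  ... | no  free⊭φ =
    let nz , lt = proj₂ (limit ½ ½>0) s (ℕ.m≤n⊔m N₁ N₂) in
    -- The arguments 1 and 1 are the numerator of ½ and its denominator less one.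
    ⊥-elim (too-few (Pφ s) (P s) half (near-one⁻ (Pφ s) (P s) {{nz}} 1 1 lt))
    where
    ½>0 : 0ℚᵘ ℚᵘ.< ½
    ½>0 = *<* (ℤ.+<+ (s≤s z≤n))
    N₁ N₂ s : ℕ
    N₁ = proj₁ (sparse 2)
    N₂ = proj₁ (limit ½ ½>0)
    s = N₁ ⊔ N₂
    satisfying-is-close : ∀ {R} → PresentedSatisfies V R φ → Close R
    satisfying-is-close {R} R⊨φ with ℕ.<-≤-connex C _
    ... | inj₁ far  = ⊥-elim (free⊭φ (Equivalence.from (agrees R far) R⊨φ))
    ... | inj₂ near = near
    half : 2 * Pφ s ≤ P s
    half = ℕ.≤-trans (ℕ.*-monoʳ-≤ 2 (cardinality-≤ (Pφ-counts s) (filtered shift? s) (λ (le , R⊨φ) → le , satisfying-is-close R⊨φ)))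
      (ℕ.≤-trans (proj₂ (sparse 2) s (ℕ.m≤m⊔n N₁ N₂)) (cardinality-≤ (all s) (P-counts s) (λ le → le)))
    too-few : ∀ b t → 2 * b ≤ t → ¬ (ℤ.∣ b ⊖ t ∣ * 2 < 1 * t)
    too-few b t 2b≤t lt = ℕ.<⇒≱ lt (begin
      1 * t                 ≡⟨ ℕ.*-identityˡ t ⟩
      t                     ≤⟨ ℕ.m+n≤o⇒m≤o∸n t (ℕ.≤-trans (ℕ.+-monoʳ-≤ t 2b≤t) (ℕ.≤-reflexive (cong (t +_) (≡.sym (ℕ.+-identityʳ t))))) ⟩
      2 * t ∸ 2 * b         ≡⟨ ℕ.*-distribˡ-∸ 2 t b ⟨
      2 * (t ∸ b)           ≡⟨ ℕ.*-comm 2 (t ∸ b) ⟩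
      (t ∸ b) * 2           ≡⟨ cong (_* 2) (ℤ.∣⊖∣-≤ (ℕ.≤-trans (ℕ.m≤m+n b (b + 0)) 2b≤t)) ⟨
      ℤ.∣ b ⊖ t ∣ * 2       ∎)
      where open ℕ.≤-Reasoning

theorem5p7 : ExcludedMiddle (lsuc 0ℓ) →
    (n m : ℕ) .{{_ : NonZero m}} (V : Variety n) →
    GeneralizedBijective V → Commutative V → Infinite (Free V 1) →
    (φ : Sentence n m) → FreeSatisfies V φ ⇔ LimitingDensity V φ 1ℚᵘ
theorem5p7 em n m V bijective commutative infinite φ =
  let χ , (h , χh≢0) , invariant = Character.character em V bijective commutative infinite
      C , agrees = Presentations.presented-agrees em V bijective commutative infinite χ
                     (λ {u} {v} → invariant {u} {v}) h χh≢0 φ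
  in mk⇔ (Density.dense em V φ χ h χh≢0 C agrees) (Density.true-in-free em V φ χ h χh≢0 C agrees)
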